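{- For every prime $p$, every even positive integer $n$ and every positive integer $m\le n/2$, there exist an almost balanced bent function $F\colon\mathbb{F}_p^n\to\mathbb{F}_p^m$ of type $(+)$ and an almost balanced bent function $F\colon\mathbb{F}_p^n\to\mathbb{F}_p^m$ of type $(-)$.
   Context: A function $F\colon\mathbb{F}_p^n\to\mathbb{F}_p^m$ is bent (perfect nonlinear) if $|\{x: F(x+a)-F(x)=b\}|=p^{n-m}$ for all nonzero $a\in\mathbb{F}_p^n$ and all $b\in\mathbb{F}_p^m$. A bent function $F\colon\mathbb{F}_p^n\to\mathbb{F}_p^m$ is almost balanced of type $(+)$ if for some $\alpha\in\mathbb{F}_p^m$, $|F^{ -1}(\alpha)|=p^{n-m}+p^{n/2}-p^{n/2-m}$ and $|F^{ -1}(\beta)|=p^{n-m}-p^{n/2-m}$ for all $\beta\neq\alpha$; it is almost balanced of type $(-)$ if for some $\alpha$, $|F^{ -1}(\alpha)|=p^{n-m}-p^{n/2}+p^{n/2-m}$ and $|F^{ -1}(\beta)|=p^{n-m}+p^{n/2-m}$ for all $\beta\neq\alpha$. -}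

module Defs where

open import Data.Fin.Base using (Fin; toℕ)
open import Data.Nat.Base using (ℕ; NonZero; _+_; _∸_; _^_)
open import Data.Nat.DivMod using (_/_; _mod_)
open import Data.Product.Base using (Σ; ∃-syntax; _×_)
open import Data.Vec.Base using (Vec; replicate; zipWith)
open import Function.Bundles using (_↔_)
open import Relation.Binary.PropositionalEquality.Core using (_≡_; _≢_)

-- 𝔽 p is ℤ/pℤ on the residues 0, …, p - 1.  Bentness and almost balancedness
-- involve the field only through its additive group.
𝔽 : ℕ → Set
𝔽 p = Fin p

𝔽^ : ℕ → ℕ → Set
𝔽^ p n = Vec (𝔽 p) n

infixl 6 _+ₚ_ _-ₚ_ _⊕_ _⊖_

_+ₚ_ : ∀ {p} .{{_ : NonZero p}} → 𝔽 p → 𝔽 p → 𝔽 p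
_+ₚ_ {p} x y = (toℕ x + toℕ y) mod p

_-ₚ_ : ∀ {p} .{{_ : NonZero p}} → 𝔽 p → 𝔽 p → 𝔽 p
_-ₚ_ {p} x y = (toℕ x + (p ∸ toℕ y)) mod p

0ᵥ : ∀ {p n} .{{_ : NonZero p}} → 𝔽^ p n
0ᵥ {p} {n} = replicate n (0 mod p)

_⊕_ : ∀ {p n} .{{_ : NonZero p}} → 𝔽^ p n → 𝔽^ p n → 𝔽^ p n
_⊕_ = zipWith _+ₚ_

_⊖_ : ∀ {p n} .{{_ : NonZero p}} → 𝔽^ p n → 𝔽^ p n → 𝔽^ p n
_⊖_ = zipWith _-ₚ_

-- Below, A is always a subset {x | P x} of 𝔽^ p n, given as Σ x (P x) with P x
-- an equation in a type with decidable equality; P x has at most one proof, so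
-- elements of the Σ-type are elements of the subset.
HasCardinality : Set → ℕ → Set
HasCardinality A k = A ↔ Fin k

Fibre : ∀ {p n m} → (𝔽^ p n → 𝔽^ p m) → 𝔽^ p m → Set
Fibre {p} {n} F β = Σ (𝔽^ p n) λ x → F x ≡ β

-- If n < m then n ∸ m = 0, but for p ≥ 2 and n ≥ 1 no F satisfies the condition
-- in that case: summing over b would give p ^ m = p ^ n.
Bent : ∀ {p n m} .{{_ : NonZero p}} → (𝔽^ p n → 𝔽^ p m) → Set
Bent {p} {n} {m} F =
  ∀ (a : 𝔽^ p n) → a ≢ 0ᵥ → ∀ (b : 𝔽^ p m) →
  HasCardinality (Fibre (λ x → F (x ⊕ a) ⊖ F x) b) (p ^ (n ∸ m))

-- The two types of almost balancedness are meant for n even and m ≤ n / 2.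
-- Then every truncated subtraction below is exact, because
-- p ^ (n ∸ m) ≥ p ^ (n / 2) ≥ p ^ (n / 2 ∸ m).
AlmostBalanced⁺ : ∀ {p n m} → (𝔽^ p n → 𝔽^ p m) → Set
AlmostBalanced⁺ {p} {n} {m} F =
  ∃[ α ] HasCardinality (Fibre F α) (p ^ (n ∸ m) + p ^ (n / 2) ∸ p ^ (n / 2 ∸ m))
       × (∀ β → β ≢ α →
          HasCardinality (Fibre F β) (p ^ (n ∸ m) ∸ p ^ (n / 2 ∸ m)))

AlmostBalanced⁻ : ∀ {p n m} → (𝔽^ p n → 𝔽^ p m) → Set
AlmostBalanced⁻ {p} {n} {m} F =
  ∃[ α ] HasCardinality (Fibre F α) (p ^ (n ∸ m) ∸ p ^ (n / 2) + p ^ (n / 2 ∸ m))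
       × (∀ β → β ≢ α →
          HasCardinality (Fibre F β) (p ^ (n ∸ m) + p ^ (n / 2 ∸ m)))

{-# OPTIONS --safe #-}
module Submission where

-- Write n = 2k and q = pᵏ.  Over a field K with q elements the maps K² → K,
-- (x , y) ↦ x y and (x , y) ↦ x² + x y + d y² (with t² + t + d rootless), are
-- perfect nonlinear: their derivatives are nonzero affine forms.  The first has
-- 2q - 1 zeros and all its other fibres have q - 1 elements.  The second has one
-- zero, and the first two moments of its fibre sizes then force all other fibres
-- to have q + 1 elements.  Composing with a projection K = 𝔽ₚᵏ → 𝔽ₚᵐ gives the
-- two types.
--
-- The field is found inside the sequences of period r = q - 1 over 𝔽ₚ, on which
-- polynomials act through the shift X.  There a^q = a for every polynomial a, and
-- g = ∏_{0<e<k} (X^(pᵉ) - X) does not act as 0, because deg g < r.  Let w be a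
-- nonzero sequence in the image of g satisfying a monic linear recurrence of
-- least possible order d.  By minimality the polynomials modulo the annihilator
-- of w form a domain with basis 1, …, X^(d-1).  Its pᵈ elements are roots of
-- T^q - T, so d ≤ k; the recurrence has the k distinct roots X^(pᵉ), so k ≤ d.

open import Defs
open import Data.Nat.Base using (ℕ; NonZero; _≤_; _<_)
open import Data.Nat.Divisibility using (_∣_)
open import Data.Nat.DivMod using (_/_)
open import Data.Nat.Primality using (Prime)
open import Data.Product.Base using (Σ; _×_)
open import Algebra.Bundles using (CommutativeRing; RawRing)
open import Data.Fin.Base using (Fin; zero; suc; toℕ; fromℕ; inject₁; punchOut; combine; _↑ˡ_; _↑ʳ_)
import Data.Fin.Properties as Fin
open import Data.Nat.Base as ℕ using (zero; suc; z≤n; s≤s; _!; _∸_)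
open import Data.Nat.Combinatorics using (_C_; nCn≡1; nCk≡n!/k![n-k]!; k![n∸k]!∣n!)
open import Data.Nat.Divisibility using (divides; ∣⇒≤; m∣m*n; m%n≡0⇒n∣m; n∣m⇒m%n≡0)
open import Data.Nat.DivMod using (_%_; _mod_; m/n*n≡m; m%n<n; m≡m%n+[m/n]*n; m<n⇒m%n≡m; [m+n]%n≡m%n; %-distribˡ-+; %-distribˡ-*; n%n≡0; m*n/n≡m)
open import Data.Nat.Primality using (euclidsLemma; prime⇒nonTrivial)
import Data.Nat.Properties as ℕ
open import Data.Product.Base using (_,_; ∃-syntax; proj₁; proj₂)
open import Data.Sum.Base using (_⊎_; inj₁; inj₂; [_,_]′)
open import Function.Base using (_∘_)
open import Level using (_⊔_; 0ℓ)
import Relation.Binary.PropositionalEquality as ≡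
open ≡ using (_≡_; _≢_)
open import Relation.Nullary using (¬_; Dec; yes; no; contradiction; Irrelevant)

-- Minimality of `d` plays the part of an irreducible factor of degree `k`: polynomials are compared
-- by their effect on one periodic sequence, which is decidable, and a zero divisor would produce a
-- shorter recurrence. The product `g` is there to exclude proper subfields. Among all sequences of
-- period `r` the constant ones satisfy a recurrence of order 1, so minimality alone would always
-- return 𝔽ₚ. On a nonzero `w = g v` no factor X^(pᵉ) - X with 0 < e < k can vanish: otherwise g² v
-- = 0, and a^q = a would give g v = 0. Hence the `k` conjugates of X stay distinct. The law a^q = a
-- itself comes from the choice of `r`, as X^q = X^(r+1) = X, together with the additivity of
-- Frobenius. On the side of the functions, the form x² + x y + d y² is nondegenerate in every
-- characteristic, 2 included. Its fibres are accessible through moments because pairs of points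
-- with equal values are exactly zeros of derivatives, so perfect nonlinearity fixes the sum of the
-- squared fibre sizes. Counts live in ℕ; identities are therefore stated with every subtracted term
-- moved to the other side.

-- Frobenius in characteristic p.

prime∤! : ∀ {p} → Prime p → ∀ k → k < p → ¬ p ∣ k !
prime∤! {p} pr zero k<p p∣1 = ℕ.<⇒≱ (ℕ.nonTrivial⇒n>1 p {{prime⇒nonTrivial pr}}) (∣⇒≤ p∣1)
prime∤! {p} pr (suc k) k<p p∣ = [ (λ d → ℕ.<⇒≱ k<p (∣⇒≤ d)) , prime∤! pr k (ℕ.<-trans (ℕ.n<1+n k) k<p) ]′
  (euclidsLemma (suc k) (k !) pr p∣)

-- `p` divides `p !`, the product of the binomial coefficient with two factorials of numbers below
-- `p`; those factorials are prime to `p`.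
prime∣C : ∀ {p} → Prime p → ∀ k → 0 < k → k < p → p ∣ p C k
prime∣C {p@(suc p-1)} pr k 0<k k<p = [ (λ d → d) , (λ d → contradiction (euclidsLemma (k !) ((p ∸ k) !) pr d)
    [ prime∤! pr k k<p , prime∤! pr (p ∸ k) (ℕ.∸-monoʳ-< 0<k (ℕ.<⇒≤ k<p)) ]′) ]′
  (euclidsLemma (p C k) (k ! ℕ.* (p ∸ k) !) pr p∣C*)
  where
  instance _ = k ℕ.!* (p ∸ k) !≢0
  p∣C* : p ∣ (p C k) ℕ.* (k ! ℕ.* (p ∸ k) !)
  p∣C* = ≡.subst (p ∣_)
    (≡.sym (≡.trans (≡.cong (ℕ._* (k ! ℕ.* (p ∸ k) !)) (nCk≡n!/k![n-k]! (ℕ.<⇒≤ k<p)))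
      (m/n*n≡m (k![n∸k]!∣n! (ℕ.<⇒≤ k<p)))))
    (m∣m*n (p-1 !))

module Frobenius {c ℓ} (R : CommutativeRing c ℓ) where
  open CommutativeRing R hiding (zero)
  open import Algebra.Properties.Semiring.Exp semiring
  open import Algebra.Properties.Semiring.Mult semiring renaming (_×_ to _·_)
  open import Algebra.Properties.Semiring.Sum semiring using (sum; sum-cong-≋; sum-init-last; sum-replicate-zero)
  open import Algebra.Properties.CommutativeSemiring.Binomial commutativeSemiring using (binomialTerm; theorem)
  open import Relation.Binary.Reasoning.Setoid setoid

  module _ {p} (pr : Prime p) (char : p · 1# ≈ 0#) where

    ∣⇒·≈0 : ∀ {n} → p ∣ n → ∀ x → n · x ≈ 0#
    ∣⇒·≈0 (divides q ≡.refl) x = begin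
      (q ℕ.* p) · x         ≈⟨ ×-assocˡ x q p ⟨
      q · (p · x)           ≈⟨ ×-congʳ q (×-congʳ p (*-identityˡ x)) ⟨
      q · (p · (1# * x))    ≈⟨ ×-congʳ q (×-assoc-* p 1# x) ⟨
      q · ((p · 1#) * x)    ≈⟨ ×-congʳ q (*-congʳ char) ⟩
      q · (0# * x)          ≈⟨ ×-congʳ q (zeroˡ x) ⟩
      q · 0#                ≈⟨ ×-congʳ q (zeroˡ 0#) ⟨
      q · (0# * 0#)         ≈⟨ ×-assoc-* q 0# 0# ⟨
      (q · 0#) * 0#         ≈⟨ zeroʳ _ ⟩
      0#                    ∎

    ^p-homo-+ : ∀ x y → (x + y) ^ p ≈ x ^ p + y ^ p
    ^p-homo-+ = go p ≡.refl
      where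
      -- The exponent is generalised so that it can be matched as a successor, which exposes the
      -- first and last binomial terms; those in between vanish by `prime∣C`.
      go : ∀ n → n ≡ p → ∀ x y → (x + y) ^ n ≈ x ^ n + y ^ n
      go zero ≡.refl = contradiction pr (λ ())
      go n@(suc n-1) ≡.refl x y = begin
        (x + y) ^ n                                   ≈⟨ theorem n x y ⟩
        t zero + sum (t ∘ suc)                        ≈⟨ +-cong first (sum-init-last (t ∘ suc)) ⟩
        y ^ n + (sum (t ∘ suc ∘ inject₁) + t (suc (fromℕ n-1)))
          ≈⟨ +-congˡ (+-cong (trans (sum-cong-≋ middle) (sum-replicate-zero n-1)) last) ⟩
        y ^ n + (0# + x ^ n)                          ≈⟨ +-congˡ (+-identityˡ _) ⟩
        y ^ n + x ^ n                                 ≈⟨ +-comm _ _ ⟩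
        x ^ n + y ^ n                                 ∎
        where
        t = binomialTerm x y n
        first : t zero ≈ y ^ n
        first = trans (+-identityʳ _) (*-identityˡ _)
        middle : ∀ i → t (suc (inject₁ i)) ≈ 0#
        middle i = ∣⇒·≈0 (prime∣C pr (toℕ (suc (inject₁ i))) (s≤s z≤n)
          (s≤s (≡.subst (_< n-1) (≡.sym (Fin.toℕ-inject₁ i)) (Fin.toℕ<n i)))) _
        last : t (suc (fromℕ n-1)) ≈ x ^ n
        last = begin
          (n C suc k) · (x ^ suc k * y ^ (n-1 ∸ k))
            ≡⟨ ≡.cong (λ k → (n C suc k) · (x ^ suc k * y ^ (n-1 ∸ k))) (Fin.toℕ-fromℕ n-1) ⟩
          (n C n) · (x ^ n * y ^ (n-1 ∸ n-1))
            ≡⟨ ≡.cong₂ (λ a b → a · (x ^ n * y ^ b)) (nCn≡1 n) (ℕ.n∸n≡0 n-1) ⟩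
          1 · (x ^ n * 1#)  ≈⟨ ×-homo-1 _ ⟩
          x ^ n * 1#        ≈⟨ *-identityʳ _ ⟩
          x ^ n             ∎
          where k = toℕ (fromℕ n-1)

    ^pᵉ-homo-+ : ∀ e x y → (x + y) ^ (p ℕ.^ e) ≈ x ^ (p ℕ.^ e) + y ^ (p ℕ.^ e)
    ^pᵉ-homo-+ zero x y = trans (*-identityʳ _) (sym (+-cong (*-identityʳ _) (*-identityʳ _)))
    ^pᵉ-homo-+ (suc e) x y = begin
      (x + y) ^ (p ℕ.* p ℕ.^ e)                  ≈⟨ ^-assocʳ (x + y) p (p ℕ.^ e) ⟨
      ((x + y) ^ p) ^ (p ℕ.^ e)                  ≈⟨ ^-congˡ (p ℕ.^ e) (^p-homo-+ x y) ⟩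
      (x ^ p + y ^ p) ^ (p ℕ.^ e)                ≈⟨ ^pᵉ-homo-+ e (x ^ p) (y ^ p) ⟩
      (x ^ p) ^ (p ℕ.^ e) + (y ^ p) ^ (p ℕ.^ e)  ≈⟨ +-cong (^-assocʳ x p (p ℕ.^ e)) (^-assocʳ y p (p ℕ.^ e)) ⟩
      x ^ (p ℕ.* p ℕ.^ e) + y ^ (p ℕ.* p ℕ.^ e)  ∎

-- Roots of monic polynomial functions over a domain.

module MonicRoots {c ℓ} (R : CommutativeRing c ℓ) where
  open CommutativeRing R hiding (zero)
  open import Algebra.Properties.Semiring.Exp semiring
  open import Relation.Binary.Reasoning.Setoid setoid
  open import Algebra.Solver.Ring.NaturalCoefficients.Default commutativeSemiring using (solve; _:+_; _:*_; _:=_)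
  open import Algebra.Properties.Group +-group using (x∙y⁻¹≈ε⇒x≈y)
  open import Algebra.Properties.Ring ring using (-‿distribʳ-*)
  private
    x≈x-a+a : ∀ x a → x ≈ (x - a) + a
    x≈x-a+a x a = sym (trans (+-assoc x (- a) a) (trans (+-congˡ (-‿inverseˡ a)) (+-identityʳ x)))

    divide-linear : ∀ c x a q → c + x * q ≈ (x - a) * q + (c + a * q)
    divide-linear c x a q = trans (+-congˡ (*-congʳ (x≈x-a+a x a))) (solve 4 (λ c d a q → c :+ (d :+ a) :* q := d :* q :+ (c :+ a :* q)) refl c (x - a) a q)

    divide-horner : ∀ c x a q m → c + x * ((x - a) * q + m) ≈ (x - a) * (m + x * q) + (c + a * m)
    divide-horner c x a q m = trans (+-congˡ (*-congʳ (x≈x-a+a x a)))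
      (trans (solve 5 (λ c d a q m → c :+ (d :+ a) :* (d :* q :+ m) := d :* (m :+ (d :+ a) :* q) :+ (c :+ a :* m)) refl c (x - a) a q m) (+-congʳ (*-congˡ (+-congˡ (*-congʳ (sym (x≈x-a+a x a)))))))

  -- A polynomial over `R` is kept as a function with a Horner scheme, up to pointwise equality.
  -- Root counting only evaluates, and `R` will itself be a ring of polynomials.
  data Monic : ℕ → (Carrier → Carrier) → Set (c ⊔ ℓ) where
    one    : ∀ {P} → (∀ x → P x ≈ 1#) → Monic 0 P
    horner : ∀ {n P} c {Q} → Monic n Q → (∀ x → P x ≈ c + x * Q x) → Monic (suc n) P

  -- Synthetic division: if `M x` is `(x - a) * Q x + M a`, then `c + x * M x` has quotient
  -- `M a + x * Q x`, again in Horner form with leading coefficient one.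
  divideOut : ∀ {n P} → Monic (suc n) P → ∀ a →
              ∃[ Q ] Monic n Q × (∀ x → P x ≈ (x - a) * Q x + P a)
  divideOut (horner {zero} c {Q} (one Q≈1) P≈) a = Q , one Q≈1 , λ x → begin
    _                                ≈⟨ P≈ x ⟩
    c + x * Q x                      ≈⟨ divide-linear c x a (Q x) ⟩
    (x - a) * Q x + (c + a * Q x)    ≈⟨ +-congˡ (+-congˡ (*-congˡ (trans (Q≈1 x) (sym (Q≈1 a))))) ⟩
    (x - a) * Q x + (c + a * Q a)    ≈⟨ +-congˡ (P≈ a) ⟨
    _                                ∎
  divideOut (horner {suc n} c {M} mon P≈) a with divideOut mon a
  ... | Q , monQ , M≈ = (λ x → M a + x * Q x) , horner (M a) monQ (λ _ → refl) , λ x → begin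
    _                                               ≈⟨ P≈ x ⟩
    c + x * M x                                     ≈⟨ +-congˡ (*-congˡ (M≈ x)) ⟩
    c + x * ((x - a) * Q x + M a)                   ≈⟨ divide-horner c x a (Q x) (M a) ⟩
    (x - a) * (M a + x * Q x) + (c + a * M a)       ≈⟨ +-congˡ (P≈ a) ⟨
    _                                               ∎

  module _ (domain : ∀ x y → x * y ≈ 0# → x ≈ 0# ⊎ y ≈ 0#) (1≉0 : ¬ 1# ≈ 0#) where
    -- After the first root is divided out, every other root is a root of the quotient, since its
    -- difference from the first is nonzero in a domain.
    roots≤degree : ∀ {n N P} → Monic n P → (root : Fin N → Carrier) →
                   (∀ i j → root i ≈ root j → i ≡ j) → (∀ i → P (root i) ≈ 0#) → N ≤ n
    roots≤degree {N = zero} _ _ _ _ = z≤n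
    roots≤degree {N = suc N} (one P≈1) root _ P≈0 = contradiction (trans (sym (P≈1 _)) (P≈0 zero)) 1≉0
    roots≤degree {suc n} {suc N} {P} mon root inj P≈0 with divideOut mon (root zero)
    ... | Q , monQ , P≈ = s≤s (roots≤degree monQ (root ∘ suc) (λ i j eq → suc-inj (inj _ _ eq)) Q≈0)
      where
      suc-inj : ∀ {i j : Fin N} → _≡_ {A = Fin (suc N)} (suc i) (suc j) → i ≡ j
      suc-inj ≡.refl = ≡.refl
      r₀ = root zero
      Q≈0 : ∀ i → Q (root (suc i)) ≈ 0#
      Q≈0 i with domain (root (suc i) - r₀) (Q (root (suc i))) (begin
        (root (suc i) - r₀) * Q (root (suc i))          ≈⟨ +-identityʳ _ ⟨
        (root (suc i) - r₀) * Q (root (suc i)) + 0#     ≈⟨ +-congˡ (P≈0 zero) ⟨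
        (root (suc i) - r₀) * Q (root (suc i)) + P r₀   ≈⟨ P≈ _ ⟨
        P (root (suc i))                                ≈⟨ P≈0 (suc i) ⟩
        0#                                              ∎)
      ... | inj₂ q≈0 = q≈0
      ... | inj₁ r≈ with inj _ _ (x∙y⁻¹≈ε⇒x≈y _ _ r≈)
      ... | ()

  ^-monic : ∀ n → Monic n (_^ n)
  ^-monic zero    = one (λ _ → refl)
  ^-monic (suc n) = horner 0# (^-monic n) (λ x → sym (+-identityˡ _))

  -- From `n = 2` on the term `- x` lies strictly below the leading one, with Horner coefficients
  -- `0#` and `- 1#`; for `n = 1` the function would be zero.
  x^n-x-monic : ∀ n → 2 ≤ n → Monic n (λ x → x ^ n - x)
  x^n-x-monic (suc zero) (s≤s ())
  x^n-x-monic (suc (suc n)) _ = horner 0# (horner (- 1#) (^-monic n) (λ _ → refl)) (λ x → begin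
    x * (x * x ^ n) - x                  ≈⟨ +-comm _ _ ⟩
    - x + x * (x * x ^ n)                ≈⟨ +-congʳ (-‿cong (*-identityʳ x)) ⟨
    - (x * 1#) + x * (x * x ^ n)         ≈⟨ +-congʳ (-‿distribʳ-* x 1#) ⟩
    x * - 1# + x * (x * x ^ n)           ≈⟨ distribˡ x _ _ ⟨
    x * (- 1# + x * x ^ n)               ≈⟨ +-identityˡ _ ⟨
    0# + x * (- 1# + x * x ^ n)          ∎)

open import Algebra.Core using (Op₁; Op₂)
import Algebra.Morphism.RingMonomorphism as RingMonomorphism
open import Algebra.Morphism.Structures using (IsRingMonomorphism)
open import Algebra.Properties.Semiring.Sum ℕ.+-*-semiring using (sum; sum-cong-≗; ∑-distrib-+; ∑-comm; sum-permute; *-distribˡ-sum)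
open import Algebra.Structures using (IsCommutativeRing)
open import Axiom.UniquenessOfIdentityProofs using (module Decidable⇒UIP)
open import Data.List.Base using (List; []; _∷_; map)
open import Data.Nat.Induction using (<-wellFounded; Acc; acc)
import Data.Nat.Tactic.RingSolver as ℕ-Solver
open import Data.Product.Function.NonDependent.Propositional using (_×-↔_)
open import Data.Sum.Function.Propositional using (_⊎-↔_)
open import Data.Vec.Base as Vec using (Vec; []; _∷_; toList; lookup; tabulate; take; drop; _++_)
open import Data.Vec.Properties using (≡-dec; lookup∘tabulate; toList-map; take-zipWith; drop-zipWith; take++drop≡id; ++-injective)
open import Function.Bundles using (_↔_; Inverse; mk↔ₛ′)
open import Function.Construct.Identity using (↔-id)
open import Function.Properties.Inverse using (↔-sym; ↔-trans)
open import Relation.Binary.Definitions using (DecidableEquality; tri<; tri≈; tri>)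
open ≡ using (refl; sym; trans; cong; cong₂; subst; module ≡-Reasoning)
open import Relation.Binary.PropositionalEquality.Algebra using (isMagma)
open import Relation.Nullary.Decidable using (map′; ¬?; _×-dec_; decidable-stable)

-- Finite sets: injective self-maps, division in finite domains, search.

-- If `y` were missed, `punchOut` at `y` would turn `f` into an injection of `Fin (suc n)` into
-- `Fin n`.
Fin-injective⇒surjective : ∀ {n} (f : Fin n → Fin n) → (∀ i j → f i ≡ f j → i ≡ j) → ∀ y → ∃[ x ] f x ≡ y
Fin-injective⇒surjective {suc n} f inj y with Fin.any? (λ x → f x Fin.≟ y)
... | yes ∃x = ∃x
... | no ¬∃x = contradiction (Fin.injective⇒≤ {f = λ x → punchOut (y≢f x)} λ {i} {j} eq → inj i j (Fin.punchOut-injective (y≢f i) (y≢f j) eq)) ℕ.1+n≰n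
  where
  y≢f : ∀ x → y ≢ f x
  y≢f x eq = ¬∃x (x , sym eq)

module _ {A : Set} {N : ℕ} (A↔Fin : A ↔ Fin N) where
  open Inverse A↔Fin

  to-injective : ∀ {x y} → to x ≡ to y → x ≡ y
  to-injective {x} {y} eq = trans (sym (strictlyInverseʳ x)) (trans (cong from eq) (strictlyInverseʳ y))

  from-injective : ∀ {i j} → from i ≡ from j → i ≡ j
  from-injective {i} {j} eq = trans (sym (strictlyInverseˡ i)) (trans (cong to eq) (strictlyInverseˡ j))

  injective⇒surjective : (f : A → A) → (∀ x y → f x ≡ f y → x ≡ y) → ∀ y → ∃[ x ] f x ≡ y
  injective⇒surjective f inj y
    with i , eq ← Fin-injective⇒surjective (to ∘ f ∘ from) (λ i j eq → from-injective (inj _ _ (to-injective eq))) (to y)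
    = from i , to-injective eq

module FiniteDomain {A : Set} {_+_ _*_ : Op₂ A} { -_ : Op₁ A} {0# 1# : A}
  (isCommutativeRing : IsCommutativeRing _≡_ _+_ _*_ -_ 0# 1#)
  (domain : ∀ x y → x * y ≡ 0# → x ≡ 0# ⊎ y ≡ 0#) {N : ℕ} (A↔Fin : A ↔ Fin N) where

  private
    R : CommutativeRing _ _
    R = record { isCommutativeRing = isCommutativeRing }
  open CommutativeRing R using (ring; +-group; _-_; -‿inverseʳ)
  open import Algebra.Properties.Ring ring using ([y-z]x≈yx-zx)
  open import Algebra.Properties.Group +-group using (x∙y⁻¹≈ε⇒x≈y)

  *-cancelʳ : ∀ {c} → c ≢ 0# → ∀ x y → x * c ≡ y * c → x ≡ y
  *-cancelʳ {c} c≢0 x y eq = [ x∙y⁻¹≈ε⇒x≈y x y , (λ c≡0 → contradiction c≡0 c≢0) ]′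
    (domain (x - y) c (trans ([y-z]x≈yx-zx c x y) (trans (cong (_- (y * c)) eq) (-‿inverseʳ (y * c)))))

  divide : ∀ {c} → c ≢ 0# → ∀ y → ∃[ x ] x * c ≡ y
  divide {c} c≢0 = injective⇒surjective A↔Fin (_* c) (*-cancelʳ c≢0)

∃? : ∀ {A : Set} {N} → A ↔ Fin N → {P : A → Set} → (∀ x → Dec (P x)) → Dec (∃[ x ] P x)
∃? A↔Fin {P} P? = map′ (λ (i , Pi) → from i , Pi) (λ (x , Px) → to x , subst P (sym (strictlyInverseʳ x)) Px) (Fin.any? (P? ∘ from))
  where open Inverse A↔Fin

Vec↔Fin : ∀ {A : Set} {m} → A ↔ Fin m → ∀ n → Vec A n ↔ Fin (m ℕ.^ n)
Vec↔Fin A↔ zero    = mk↔ₛ′ (λ _ → zero) (λ _ → []) (λ { zero → refl }) (λ { [] → refl })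
Vec↔Fin A↔ (suc n) = ↔-trans
  (mk↔ₛ′ (λ { (c ∷ v) → A.to c , V.to v }) (λ (c , i) → A.from c ∷ V.from i)
    (λ (c , i) → cong₂ _,_ (A.strictlyInverseˡ c) (V.strictlyInverseˡ i))
    (λ { (c ∷ v) → cong₂ _∷_ (A.strictlyInverseʳ c) (V.strictlyInverseʳ v) }))
  (↔-sym Fin.*↔×)
  where
  module A = Inverse A↔
  module V = Inverse (Vec↔Fin A↔ n)

least : ∀ {P : ℕ → Set} → (∀ n → Dec (P n)) → ∀ n → P n → ∃[ m ] P m × (∀ k → k < m → ¬ P k)
least {P} P? n Pn = go n (<-wellFounded n) Pn
  where
  go : ∀ n → Acc _<_ n → P n → ∃[ m ] P m × (∀ k → k < m → ¬ P k)
  go n (acc rec) Pn with ℕ.anyUpTo? P? n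
  ... | yes (k , k<n , Pk) = go k (rec k<n) Pk
  ... | no ¬∃ = n , Pn , λ k k<n Pk → ¬∃ (k , k<n , Pk)

-- The prime field.

module Residues (p : ℕ) .{{_ : NonZero p}} where

  F = 𝔽 p

  ι : ℕ → F
  ι n = n mod p

  ι-toℕ : ∀ x → ι (toℕ x) ≡ x
  ι-toℕ x = trans (Fin.fromℕ<-cong _ _ (m<n⇒m%n≡m (Fin.toℕ<n x)) _ (Fin.toℕ<n x)) (Fin.fromℕ<-toℕ x (Fin.toℕ<n x))

  toℕ-ι : ∀ n → toℕ (ι n) ≡ n % p
  toℕ-ι n = Fin.toℕ-fromℕ< (m%n<n n p)

  ι-cong-% : ∀ {m n} → m % p ≡ n % p → ι m ≡ ι n
  ι-cong-% eq = Fin.fromℕ<-cong _ _ eq _ _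

  infixl 7 _*ₚ_
  _*ₚ_ : F → F → F
  x *ₚ y = ι (toℕ x ℕ.* toℕ y)

  negₚ : F → F
  negₚ x = ι (p ∸ toℕ x)

  ι-homo-+ : ∀ m n → ι (m ℕ.+ n) ≡ ι m +ₚ ι n
  ι-homo-+ m n = ι-cong-% (trans (%-distribˡ-+ m n p) (sym (cong₂ (λ a b → (a ℕ.+ b) % p) (toℕ-ι m) (toℕ-ι n))))

  ι-homo-* : ∀ m n → ι (m ℕ.* n) ≡ ι m *ₚ ι n
  ι-homo-* m n = ι-cong-% (trans (%-distribˡ-* m n p) (sym (cong₂ (λ a b → (a ℕ.* b) % p) (toℕ-ι m) (toℕ-ι n))))

  ι-p : ι p ≡ ι 0
  ι-p = ι-cong-% (trans (n%n≡0 p) (sym (m<n⇒m%n≡m (ℕ.>-nonZero⁻¹ p))))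

  private

    -- This and its three companions pull the reduction `ι` to the outside, where each ring law of
    -- residues is the same law of ℕ under `ι`.
    ι+ʳ : ∀ m y → ι m +ₚ y ≡ ι (m ℕ.+ toℕ y)
    ι+ʳ m y = trans (cong (ι m +ₚ_) (sym (ι-toℕ y))) (sym (ι-homo-+ m (toℕ y)))

    ι+ˡ : ∀ x n → x +ₚ ι n ≡ ι (toℕ x ℕ.+ n)
    ι+ˡ x n = trans (cong (_+ₚ ι n) (sym (ι-toℕ x))) (sym (ι-homo-+ (toℕ x) n))

    ι*ʳ : ∀ m y → ι m *ₚ y ≡ ι (m ℕ.* toℕ y)
    ι*ʳ m y = trans (cong (ι m *ₚ_) (sym (ι-toℕ y))) (sym (ι-homo-* m (toℕ y)))

    ι*ˡ : ∀ x n → x *ₚ ι n ≡ ι (toℕ x ℕ.* n)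
    ι*ˡ x n = trans (cong (_*ₚ ι n) (sym (ι-toℕ x))) (sym (ι-homo-* (toℕ x) n))

  -ₚ≡+- : ∀ x y → x -ₚ y ≡ x +ₚ (negₚ y)
  -ₚ≡+- x y = sym (ι+ˡ x (p ∸ toℕ y))

  +ₚ-comm : ∀ x y → x +ₚ y ≡ y +ₚ x
  +ₚ-comm x y = cong ι (ℕ.+-comm (toℕ x) (toℕ y))

  +ₚ-inverseʳ : ∀ x → x +ₚ (negₚ x) ≡ ι 0
  +ₚ-inverseʳ x = trans (ι+ˡ x _) (trans (cong ι (ℕ.m+[n∸m]≡n (ℕ.<⇒≤ (Fin.toℕ<n x)))) ι-p)

  isCommutativeRing : IsCommutativeRing _≡_ _+ₚ_ _*ₚ_ negₚ (ι 0) (ι 1)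
  isCommutativeRing = record
    { isRing = record
      { +-isAbelianGroup = record
        { isGroup = record
          { isMonoid = record
            { isSemigroup = record
              { isMagma = isMagma _+ₚ_
              ; assoc = λ x y z → trans (ι+ʳ (toℕ x ℕ.+ toℕ y) z) (trans (cong ι (ℕ.+-assoc (toℕ x) (toℕ y) (toℕ z))) (sym (ι+ˡ x _)))
              }
            ; identity = (λ x → trans (ι+ʳ 0 x) (ι-toℕ x)) , (λ x → trans (ι+ˡ x 0) (trans (cong ι (ℕ.+-identityʳ _)) (ι-toℕ x)))
            }
          ; inverse = (λ x → trans (+ₚ-comm (negₚ x) x) (+ₚ-inverseʳ x)) , +ₚ-inverseʳ
          ; ⁻¹-cong = cong negₚ
          }
        ; comm = +ₚ-comm
        }
      ; *-cong = cong₂ _*ₚ_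
      ; *-assoc = λ x y z → trans (ι*ʳ (toℕ x ℕ.* toℕ y) z) (trans (cong ι (ℕ.*-assoc (toℕ x) (toℕ y) (toℕ z))) (sym (ι*ˡ x _)))
      ; *-identity = (λ x → trans (ι*ʳ 1 x) (trans (cong ι (ℕ.*-identityˡ _)) (ι-toℕ x))) , (λ x → trans (ι*ˡ x 1) (trans (cong ι (ℕ.*-identityʳ _)) (ι-toℕ x)))
      ; distrib = (λ x y z → trans (ι*ˡ x _) (trans (cong ι (ℕ.*-distribˡ-+ (toℕ x) (toℕ y) (toℕ z))) (ι-homo-+ _ _)))
                , (λ x y z → trans (ι*ʳ _ x) (trans (cong ι (ℕ.*-distribʳ-+ (toℕ x) (toℕ y) (toℕ z))) (ι-homo-+ _ _)))
      }
    ; *-comm = λ x y → cong ι (ℕ.*-comm (toℕ x) (toℕ y))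
    }

  commutativeRing : CommutativeRing _ _
  commutativeRing = record { isCommutativeRing = isCommutativeRing }

  module _ (pr : Prime p) where

    ι≡0⇒∣ : ∀ n → ι n ≡ ι 0 → p ∣ n
    ι≡0⇒∣ n eq = m%n≡0⇒n∣m n p (trans (sym (toℕ-ι n)) (trans (cong toℕ eq) (trans (toℕ-ι 0) (m<n⇒m%n≡m (ℕ.>-nonZero⁻¹ p)))))

    ∣toℕ⇒≡0 : ∀ (x : F) → p ∣ toℕ x → x ≡ ι 0
    ∣toℕ⇒≡0 x p∣x = trans (sym (ι-toℕ x)) (ι-cong-% (trans (n∣m⇒m%n≡0 (toℕ x) p p∣x) (sym (m<n⇒m%n≡m (ℕ.>-nonZero⁻¹ p)))))

    domain : ∀ x y → x *ₚ y ≡ ι 0 → x ≡ ι 0 ⊎ y ≡ ι 0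
    domain x y eq = [ (λ d → inj₁ (∣toℕ⇒≡0 x d)) , (λ d → inj₂ (∣toℕ⇒≡0 y d)) ]′
      (euclidsLemma (toℕ x) (toℕ y) pr (ι≡0⇒∣ _ eq))

    1≢0 : ι 1 ≢ ι 0
    1≢0 eq = ℕ.<⇒≱ (ℕ.nonTrivial⇒n>1 p {{prime⇒nonTrivial pr}}) (∣⇒≤ (ι≡0⇒∣ 1 eq))

-- Polynomials acting on sequences through the shift.

module PolynomialAction {F : Set} {_+_ _*_ : Op₂ F} { -_ : Op₁ F} {0# 1# : F}
  (isCommutativeRing : IsCommutativeRing _≡_ _+_ _*_ -_ 0# 1#) where

  commutativeRing : CommutativeRing _ _
  commutativeRing = record { isCommutativeRing = isCommutativeRing }

  open CommutativeRing commutativeRing using (ring; +-comm; +-assoc; +-identityˡ; +-identityʳ; -‿inverseˡ;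
    *-assoc; *-comm; *-identityˡ; zeroˡ; zeroʳ; distribˡ; distribʳ; +-commutativeSemigroup)
  open import Algebra.Properties.CommutativeSemigroup +-commutativeSemigroup using (interchange)
  open import Algebra.Properties.AbelianGroup (CommutativeRing.+-abelianGroup commutativeRing) using (⁻¹-∙-comm; ε⁻¹≈ε)
  open import Algebra.Properties.Ring ring using (-‿distribˡ-*)
  open ≡-Reasoning

  Poly : Set
  Poly = List F

  Seq : Set
  Seq = ℕ → F

  -- Coefficients are listed from the constant term up; `act a s` is the polynomial `a` in the shift
  -- operator, applied to `s`.
  act : Poly → Seq → Seq
  act []      s i = 0#
  act (c ∷ a) s i = (c * s i) + act a s (suc i)

  act-suc : ∀ a s i → act a (s ∘ suc) i ≡ act a s (suc i)
  act-suc []      s i = refl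
  act-suc (c ∷ a) s i = cong ((c * s (suc i)) +_) (act-suc a s (suc i))

  act-cong : ∀ a {s t} → (∀ i → s i ≡ t i) → ∀ i → act a s i ≡ act a t i
  act-cong []      s≡t i = refl
  act-cong (c ∷ a) s≡t i = cong₂ _+_ (cong (c *_) (s≡t i)) (act-cong a s≡t (suc i))

  act-+ˢ : ∀ a s t i → act a (λ j → s j + t j) i ≡ act a s i + act a t i
  act-+ˢ []      s t i = sym (+-identityˡ 0#)
  act-+ˢ (c ∷ a) s t i = trans (cong₂ _+_ (distribˡ c (s i) (t i)) (act-+ˢ a s t (suc i))) (interchange _ _ _ _)

  act-*ˢ : ∀ a c s i → act a (λ j → c * s j) i ≡ c * act a s i
  act-*ˢ []      c s i = sym (zeroʳ c)
  act-*ˢ (d ∷ a) c s i = begin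
    (d * (c * s i)) + act a (λ j → c * s j) (suc i)
      ≡⟨ cong₂ _+_ (trans (sym (*-assoc d c (s i))) (trans (cong (_* s i) (*-comm d c)) (*-assoc c d (s i)))) (act-*ˢ a c s (suc i)) ⟩
    (c * (d * s i)) + (c * act a s (suc i))  ≡⟨ distribˡ c _ _ ⟨
    c * ((d * s i) + act a s (suc i))        ∎

  act-0ˢ : ∀ a i → act a (λ _ → 0#) i ≡ 0#
  act-0ˢ []      i = refl
  act-0ˢ (c ∷ a) i = trans (cong₂ _+_ (zeroʳ c) (act-0ˢ a (suc i))) (+-identityˡ 0#)

  -- Polynomials in one operator commute. Commutativity of `_⊠_`, and through it congruence in the
  -- left factor, comes from here rather than from comparing coefficients.
  act-comm : ∀ a b s i → act a (act b s) i ≡ act b (act a s) i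
  act-comm []      b s i = sym (act-0ˢ b i)
  act-comm (c ∷ a) b s i = begin
    (c * act b s i) + act a (act b s) (suc i)
      ≡⟨ cong₂ _+_ (sym (act-*ˢ b c s i)) (trans (act-comm a b s (suc i)) (sym (act-suc b (act a s) i))) ⟩
    act b (λ j → c * s j) i + act b (act a s ∘ suc) i
      ≡⟨ act-+ˢ b (λ j → c * s j) (act a s ∘ suc) i ⟨
    act b (act (c ∷ a) s) i ∎

  infixl 6 _⊞_
  infixl 7 _⊠_

  _⊞_ : Poly → Poly → Poly
  []      ⊞ b       = b
  (c ∷ a) ⊞ []      = c ∷ a
  (c ∷ a) ⊞ (d ∷ b) = (c + d) ∷ (a ⊞ b)

  scale : F → Poly → Poly
  scale c = map (c *_)

  _⊠_ : Poly → Poly → Poly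
  []      ⊠ b = []
  (c ∷ a) ⊠ b = scale c b ⊞ (0# ∷ (a ⊠ b))

  ⊟_ : Poly → Poly
  ⊟_ = map -_

  const : F → Poly
  const c = c ∷ []

  X : Poly
  X = 0# ∷ 1# ∷ []

  act-⊞ : ∀ a b s i → act (a ⊞ b) s i ≡ act a s i + act b s i
  act-⊞ []      b       s i = sym (+-identityˡ _)
  act-⊞ (c ∷ a) []      s i = sym (+-identityʳ _)
  act-⊞ (c ∷ a) (d ∷ b) s i = trans (cong₂ _+_ (distribʳ (s i) c d) (act-⊞ a b s (suc i))) (interchange _ _ _ _)

  act-scale : ∀ c a s i → act (scale c a) s i ≡ c * act a s i
  act-scale c []      s i = sym (zeroʳ c)
  act-scale c (d ∷ a) s i = trans (cong₂ _+_ (*-assoc c d (s i)) (act-scale c a s (suc i))) (sym (distribˡ c _ _))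

  act-0∷ : ∀ a s i → act (0# ∷ a) s i ≡ act a s (suc i)
  act-0∷ a s i = trans (cong (_+ act a s (suc i)) (zeroˡ (s i))) (+-identityˡ _)

  act-⊠ : ∀ a b s i → act (a ⊠ b) s i ≡ act a (act b s) i
  act-⊠ []      b s i = refl
  act-⊠ (c ∷ a) b s i = trans (act-⊞ (scale c b) (0# ∷ (a ⊠ b)) s i)
    (cong₂ _+_ (act-scale c b s i) (trans (act-0∷ (a ⊠ b) s i) (act-⊠ a b s (suc i))))

  act-⊟ : ∀ a s i → act (⊟ a) s i ≡ - act a s i
  act-⊟ []      s i = sym ε⁻¹≈ε
  act-⊟ (c ∷ a) s i = trans (cong₂ _+_ (sym (-‿distribˡ-* c (s i))) (act-⊟ a s (suc i))) (⁻¹-∙-comm _ _)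

  act-const : ∀ c s i → act (const c) s i ≡ c * s i
  act-const c s i = +-identityʳ _

  act-1 : ∀ s i → act (const 1#) s i ≡ s i
  act-1 s i = trans (act-const 1# s i) (*-identityˡ _)

  act-X : ∀ s i → act X s i ≡ s (suc i)
  act-X s i = trans (act-0∷ (const 1#) s i) (act-1 s (suc i))

  act-∷ : ∀ c a s i → act (c ∷ a) s i ≡ act (const c ⊞ (X ⊠ a)) s i
  act-∷ c a s i = sym (begin
    act (const c ⊞ (X ⊠ a)) s i              ≡⟨ act-⊞ (const c) (X ⊠ a) s i ⟩
    act (const c) s i + act (X ⊠ a) s i      ≡⟨ cong₂ _+_ (act-const c s i) (trans (act-⊠ X a s i) (act-X (act a s) i)) ⟩
    (c * s i) + act a s (suc i)              ∎)

  module At (v : Seq) where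

    infix 4 _≈_
    -- Congruence modulo the annihilator of `v`, so that `polyRing` is the quotient of the
    -- polynomial ring by that annihilator. The record keeps `a` and `b` recoverable from the type.
    record _≈_ (a b : Poly) : Set where
      constructor ⟪_⟫
      field at : ∀ i → act a v i ≡ act b v i
    open _≈_ public

    private
      via : ∀ {a b} (f g : Seq) → (∀ i → act a v i ≡ f i) → (∀ i → act b v i ≡ g i) → (∀ i → f i ≡ g i) → a ≈ b
      via f g a≡f b≡g f≡g = ⟪ (λ i → trans (a≡f i) (trans (f≡g i) (sym (b≡g i)))) ⟫

      ⟦+⟧ : ∀ a b {f g : Seq} → (∀ i → act a v i ≡ f i) → (∀ i → act b v i ≡ g i) → ∀ i → act (a ⊞ b) v i ≡ f i + g i
      ⟦+⟧ a b a≡f b≡g i = trans (act-⊞ a b v i) (cong₂ _+_ (a≡f i) (b≡g i))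

      rfl : ∀ {f : Seq} i → f i ≡ f i
      rfl i = refl

      ⟦*⟧ : ∀ a b → ∀ i → act (a ⊠ b) v i ≡ act a (act b v) i
      ⟦*⟧ a b = act-⊠ a b v

    ⊞-cong : ∀ {a a′ b b′} → a ≈ a′ → b ≈ b′ → a ⊞ b ≈ a′ ⊞ b′
    ⊞-cong {a} {a′} {b} {b′} p q = via _ _ (⟦+⟧ a b rfl rfl) (⟦+⟧ a′ b′ rfl rfl) (λ i → cong₂ _+_ (at p i) (at q i))

    ⊠-comm : ∀ a b → a ⊠ b ≈ b ⊠ a
    ⊠-comm a b = via _ _ (⟦*⟧ a b) (⟦*⟧ b a) (act-comm a b v)

    ⊠-congˡ : ∀ {a b b′} → b ≈ b′ → a ⊠ b ≈ a ⊠ b′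
    ⊠-congˡ {a} {b} {b′} q = via _ _ (⟦*⟧ a b) (⟦*⟧ a b′) (act-cong a (at q))

    ≈-trans : ∀ {a b c} → a ≈ b → b ≈ c → a ≈ c
    ≈-trans p q = ⟪ (λ i → trans (at p i) (at q i)) ⟫

    ⊠-cong : ∀ {a a′ b b′} → a ≈ a′ → b ≈ b′ → a ⊠ b ≈ a′ ⊠ b′
    ⊠-cong {a} {a′} {b} {b′} p q = ≈-trans (⊠-comm a b) (≈-trans (⊠-congˡ {b} {a} {a′} p) (≈-trans (⊠-comm b a′) (⊠-congˡ {a′} q)))

    ⊠-identityˡ : ∀ a → const 1# ⊠ a ≈ a
    ⊠-identityˡ a = via _ _ (⟦*⟧ (const 1#) a) rfl (act-1 (act a v))

    ⊠-distribˡ : ∀ a b c → a ⊠ (b ⊞ c) ≈ a ⊠ b ⊞ a ⊠ c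
    ⊠-distribˡ a b c = via _ _ (⟦*⟧ a (b ⊞ c)) (⟦+⟧ (a ⊠ b) (a ⊠ c) (⟦*⟧ a b) (⟦*⟧ a c))
      (λ i → trans (act-cong a (act-⊞ b c v) i) (act-+ˢ a (act b v) (act c v) i))

    ⊞-comm : ∀ a b → a ⊞ b ≈ b ⊞ a
    ⊞-comm a b = via _ _ (⟦+⟧ a b rfl rfl) (⟦+⟧ b a rfl rfl) (λ i → +-comm _ _)

    ⊞-inverseˡ : ∀ a → (⊟ a) ⊞ a ≈ []
    ⊞-inverseˡ a = via _ _ (⟦+⟧ (⊟ a) a (act-⊟ a v) rfl) rfl (λ i → -‿inverseˡ _)

    polyRing : CommutativeRing 0ℓ 0ℓ
    polyRing = record
      { Carrier = Poly ; _≈_ = _≈_ ; _+_ = _⊞_ ; _*_ = _⊠_ ; -_ = ⊟_ ; 0# = [] ; 1# = const 1#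
      ; isCommutativeRing = record
        { isRing = record
          { +-isAbelianGroup = record
            { isGroup = record
              { isMonoid = record
                { isSemigroup = record
                  { isMagma = record
                    { isEquivalence = record { refl = ⟪ rfl ⟫ ; sym = λ p → ⟪ (λ i → sym (at p i)) ⟫ ; trans = ≈-trans }
                    ; ∙-cong = ⊞-cong
                    }
                  ; assoc = λ a b c → via _ _ (⟦+⟧ (a ⊞ b) c (⟦+⟧ a b rfl rfl) rfl) (⟦+⟧ a (b ⊞ c) rfl (⟦+⟧ b c rfl rfl)) (λ i → +-assoc _ _ _)
                  }
                ; identity = (λ a → ⟪ rfl ⟫) , (λ a → ≈-trans (⊞-comm a []) ⟪ rfl ⟫)
                }
              ; inverse = ⊞-inverseˡ , (λ a → ≈-trans (⊞-comm a (⊟ a)) (⊞-inverseˡ a))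
              ; ⁻¹-cong = λ {a} {b} p → via _ _ (act-⊟ a v) (act-⊟ b v) (λ i → cong -_ (at p i))
              }
            ; comm = ⊞-comm
            }
          ; *-cong = ⊠-cong
          ; *-assoc = λ a b c → via _ _ (⟦*⟧ (a ⊠ b) c) (⟦*⟧ a (b ⊠ c)) (λ i → trans (act-⊠ a b (act c v) i) (sym (act-cong a (act-⊠ b c v) i)))
          ; *-identity = ⊠-identityˡ , (λ a → ≈-trans (⊠-comm a (const 1#)) (⊠-identityˡ a))
          ; distrib = ⊠-distribˡ , (λ a b c → ≈-trans (⊠-comm (b ⊞ c) a) (≈-trans (⊠-distribˡ a b c) (⊞-cong (⊠-comm a b) (⊠-comm a c))))
          }
        ; *-comm = ⊠-comm
        }
      }

-- Linear recurrences and monic annihilators.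

module LinearRecurrences {F : Set} {_+ᶠ_ _*ᶠ_ : Op₂ F} { -ᶠ_ : Op₁ F} {0ᶠ 1ᶠ : F}
  (isCommutativeRing : IsCommutativeRing _≡_ _+ᶠ_ _*ᶠ_ -ᶠ_ 0ᶠ 1ᶠ)
  (_≟_ : DecidableEquality F) (divide : ∀ {c} → c ≢ 0ᶠ → ∀ y → ∃[ x ] (x *ᶠ c) ≡ y) where

  open PolynomialAction isCommutativeRing
  open ≡-Reasoning
  open CommutativeRing commutativeRing using (_+_; _*_; -_; 0#; 1#; ring; +-group; +-comm; +-assoc; +-identityˡ; +-identityʳ;
    *-assoc; *-identityˡ; zeroˡ; zeroʳ; distribˡ; distribʳ; +-commutativeSemigroup)
  open import Algebra.Properties.CommutativeSemigroup +-commutativeSemigroup using (interchange)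
  open import Algebra.Properties.Ring ring using (-‿distribˡ-*; -‿distribʳ-*)
  open import Algebra.Properties.Group +-group using (inverseʳ-unique)

  infixl 6 _⊞ⱽ_
  _⊞ⱽ_ : ∀ {d} → Vec F d → Vec F d → Vec F d
  _⊞ⱽ_ = Vec.zipWith _+_

  0ⱽ : ∀ {d} → Vec F d
  0ⱽ {d} = Vec.replicate d 0#

  actⱽ : ∀ {d} → Vec F d → Seq → Seq
  actⱽ u = act (toList u)

  actⱽ-⊞ⱽ : ∀ {d} (u w : Vec F d) s i → actⱽ (u ⊞ⱽ w) s i ≡ actⱽ u s i + actⱽ w s i
  actⱽ-⊞ⱽ []      []      s i = sym (+-identityˡ 0#)
  actⱽ-⊞ⱽ (c ∷ u) (d ∷ w) s i = trans (cong₂ _+_ (distribʳ (s i) c d) (actⱽ-⊞ⱽ u w s (suc i))) (interchange _ _ _ _)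

  actⱽ-0 : ∀ d s i → actⱽ (0ⱽ {d}) s i ≡ 0#
  actⱽ-0 zero    s i = refl
  actⱽ-0 (suc d) s i = trans (cong₂ _+_ (zeroˡ (s i)) (actⱽ-0 d s (suc i))) (+-identityˡ 0#)

  actⱽ-map : ∀ {d} c (u : Vec F d) s i → actⱽ (Vec.map (c *_) u) s i ≡ c * actⱽ u s i
  actⱽ-map c []      s i = sym (zeroʳ c)
  actⱽ-map c (d ∷ u) s i = trans (cong₂ _+_ (*-assoc c d (s i)) (actⱽ-map c u s (suc i))) (sym (distribˡ c _ _))

  splitTop : ∀ {d} (u : Vec F (suc d)) →
             ∃[ w ] ∃[ ℓ ] (∀ s i → actⱽ u s i ≡ actⱽ {d} w s i + ℓ * s (i ℕ.+ d))
  splitTop {zero}  (ℓ ∷ []) = [] , ℓ , λ s i → trans (+-comm _ _) (cong (λ j → 0# + ℓ * s j) (sym (ℕ.+-identityʳ i)))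
  splitTop {suc d} (c ∷ u) with w , ℓ , eq ← splitTop u = c ∷ w , ℓ , λ s i → begin
    c * s i + actⱽ u s (suc i)                                     ≡⟨ cong (c * s i +_) (eq s (suc i)) ⟩
    c * s i + (actⱽ w s (suc i) + ℓ * s (suc i ℕ.+ d))             ≡⟨ +-assoc _ _ _ ⟨
    c * s i + actⱽ w s (suc i) + ℓ * s (suc i ℕ.+ d)               ≡⟨ cong (λ j → c * s i + actⱽ w s (suc i) + ℓ * s j) (ℕ.+-suc i d) ⟨
    c * s i + actⱽ w s (suc i) + ℓ * s (i ℕ.+ suc d)               ∎

  Recurs : ∀ {d} → Vec F d → Seq → Set
  Recurs {d} f t = ∀ i → t (i ℕ.+ d) ≡ actⱽ f t i

  -- Division with remainder by the monic polynomial of the recurrence, one coefficient at a time: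
  -- `c ∷ u` has one entry too many, and the recurrence replaces its top term by `ℓ` times `f`.
  reduce : ∀ {d} (f : Vec F d) {t} → Recurs f t → ∀ a → ∃[ u ] (∀ i → act a t i ≡ actⱽ {d} u t i)
  reduce {d} f {t} rec []      = 0ⱽ , λ i → sym (actⱽ-0 d t i)
  reduce {d} f {t} rec (c ∷ a)
    with u , a≡u ← reduce f rec a
    with w , ℓ , c∷u≡ ← splitTop (c ∷ u) = w ⊞ⱽ Vec.map (ℓ *_) f , λ i → begin
    c * t i + act a t (suc i)                ≡⟨ cong (c * t i +_) (a≡u (suc i)) ⟩
    actⱽ (c ∷ u) t i                         ≡⟨ c∷u≡ t i ⟩
    actⱽ w t i + ℓ * t (i ℕ.+ d)             ≡⟨ cong (λ y → actⱽ w t i + ℓ * y) (rec i) ⟩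
    actⱽ w t i + ℓ * actⱽ f t i              ≡⟨ cong (actⱽ w t i +_) (actⱽ-map ℓ f t i) ⟨
    actⱽ w t i + actⱽ (Vec.map (ℓ *_) f) t i ≡⟨ actⱽ-⊞ⱽ w (Vec.map (ℓ *_) f) t i ⟨
    actⱽ (w ⊞ⱽ Vec.map (ℓ *_) f) t i          ∎

  leadingTerm : ∀ {d} (u : Vec F d) → u ≡ 0ⱽ ⊎
    (∃[ e ] e < d × ∃[ c ] ∃[ ℓ ] ℓ ≢ 0# × (∀ s i → actⱽ u s i ≡ actⱽ {e} c s i + ℓ * s (i ℕ.+ e)))
  leadingTerm [] = inj₁ refl
  leadingTerm {suc d} (c ∷ u) with leadingTerm u
  ... | inj₂ (e , e<d , c′ , ℓ , ℓ≢0 , eq) = inj₂ (suc e , s≤s e<d , c ∷ c′ , ℓ , ℓ≢0 , λ s i → begin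
    c * s i + actⱽ u s (suc i)                              ≡⟨ cong (c * s i +_) (eq s (suc i)) ⟩
    c * s i + (actⱽ c′ s (suc i) + ℓ * s (suc i ℕ.+ e))     ≡⟨ +-assoc _ _ _ ⟨
    c * s i + actⱽ c′ s (suc i) + ℓ * s (suc i ℕ.+ e)       ≡⟨ cong (λ j → c * s i + actⱽ c′ s (suc i) + ℓ * s j) (ℕ.+-suc i e) ⟨
    c * s i + actⱽ c′ s (suc i) + ℓ * s (i ℕ.+ suc e)       ∎)
  ... | inj₁ refl with c ≟ 0#
  ...   | yes refl = inj₁ refl
  ...   | no c≢0 = inj₂ (0 , s≤s z≤n , [] , c , c≢0 , λ s i →
    trans (+-comm _ _) (cong₂ _+_ (actⱽ-0 d s (suc i)) (cong (λ j → c * s j) (sym (ℕ.+-identityʳ i)))))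

  -- Dividing by the leading coefficient turns an annihilator into a monic one. Having only `d`
  -- coefficients it has degree below `d`, which is what will contradict minimality.
  annihilated⇒recurs : ∀ {d} (u : Vec F d) t → u ≢ 0ⱽ → (∀ i → actⱽ u t i ≡ 0#) →
                       ∃[ e ] e < d × ∃[ c ] Recurs {e} c t
  annihilated⇒recurs u t u≢0 u·t≡0 with leadingTerm u
  ... | inj₁ u≡0 = contradiction u≡0 u≢0
  ... | inj₂ (e , e<d , c , ℓ , ℓ≢0 , eq) with ℓ⁻¹ , ℓ⁻¹ℓ≡1 ← divide ℓ≢0 1# =
    e , e<d , Vec.map (- ℓ⁻¹ *_) c , λ i → begin
    t (i ℕ.+ e)                        ≡⟨ *-identityˡ _ ⟨
    1# * t (i ℕ.+ e)                   ≡⟨ cong (_* t (i ℕ.+ e)) ℓ⁻¹ℓ≡1 ⟨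
    ℓ⁻¹ * ℓ * t (i ℕ.+ e)              ≡⟨ *-assoc ℓ⁻¹ ℓ _ ⟩
    ℓ⁻¹ * (ℓ * t (i ℕ.+ e))            ≡⟨ cong (ℓ⁻¹ *_) (inverseʳ-unique _ _ (trans (sym (eq t i)) (u·t≡0 i))) ⟩
    ℓ⁻¹ * - actⱽ c t i                 ≡⟨ -‿distribʳ-* ℓ⁻¹ _ ⟨
    - (ℓ⁻¹ * actⱽ c t i)               ≡⟨ -‿distribˡ-* ℓ⁻¹ _ ⟩
    - ℓ⁻¹ * actⱽ c t i                 ≡⟨ actⱽ-map (- ℓ⁻¹) c t i ⟨
    actⱽ (Vec.map (- ℓ⁻¹ *_) c) t i    ∎

  -- a is a monic polynomial of degree D, seen through its action.
  Leads : ℕ → Poly → Set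
  Leads D a = ∀ s i → (∀ j → j < D → s (i ℕ.+ j) ≡ 0#) → act a s i ≡ s (i ℕ.+ D)

  1-leads : Leads 0 (const 1#)
  1-leads s i _ = trans (act-1 s i) (cong s (sym (ℕ.+-identityʳ i)))

  ⊠-leads : ∀ {D E a b} → Leads D a → Leads E b → Leads (D ℕ.+ E) (a ⊠ b)
  ⊠-leads {D} {E} {a} {b} la lb s i s≡0 = begin
    act (a ⊠ b) s i         ≡⟨ act-⊠ a b s i ⟩
    act a (act b s) i       ≡⟨ la (act b s) i (λ j j<D → trans (b-leads j (ℕ.<⇒≤ j<D)) (trans (cong s (ℕ.+-assoc i j E)) (s≡0 (j ℕ.+ E) (ℕ.+-monoˡ-< E j<D)))) ⟩
    act b s (i ℕ.+ D)       ≡⟨ b-leads D ℕ.≤-refl ⟩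
    s (i ℕ.+ D ℕ.+ E)       ≡⟨ cong s (ℕ.+-assoc i D E) ⟩
    s (i ℕ.+ (D ℕ.+ E))     ∎
    where
    -- On the window of zeros `b` acts as the shift by `E`. Offsets below `D` supply the zeros that
    -- `a` asks for, and offset `D` itself, hence the weak inequality, supplies the value.
    b-leads : ∀ j → j ℕ.≤ D → act b s (i ℕ.+ j) ≡ s (i ℕ.+ j ℕ.+ E)
    b-leads j j≤D = lb s (i ℕ.+ j) (λ l l<E → trans (cong s (ℕ.+-assoc i j l)) (s≡0 (j ℕ.+ l) (ℕ.+-mono-≤-< j≤D l<E)))

-- Periodic sequences and the Frobenius action on them.

module FieldConstruction {F : Set} {_+ᶠ_ _*ᶠ_ : Op₂ F} { -ᶠ_ : Op₁ F} {0ᶠ 1ᶠ : F}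
  (isCommutativeRing : IsCommutativeRing _≡_ _+ᶠ_ _*ᶠ_ -ᶠ_ 0ᶠ 1ᶠ) (_≟_ : DecidableEquality F)
  (divide : ∀ {c} → c ≢ 0ᶠ → ∀ y → ∃[ x ] (x *ᶠ c) ≡ y) (1≢0 : 1ᶠ ≢ 0ᶠ) where

  open PolynomialAction isCommutativeRing
  open LinearRecurrences isCommutativeRing _≟_ divide
  open CommutativeRing commutativeRing using (_+_; _*_; -_; _-_; 0#; 1#; ring; +-group; +-comm; +-assoc; +-identityˡ; +-identityʳ; -‿inverseʳ; semiring;
    *-assoc; *-comm; *-identityˡ; zeroˡ; distribˡ)
  open import Algebra.Properties.Group +-group using (x∙y⁻¹≈ε⇒x≈y)

  mono : ℕ → Poly
  mono zero    = const 1#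
  mono (suc n) = 0# ∷ mono n

  act-mono : ∀ n s i → act (mono n) s i ≡ s (n ℕ.+ i)
  act-mono zero    s i = act-1 s i
  act-mono (suc n) s i = trans (act-0∷ (mono n) s i) (trans (act-mono n s (suc i)) (cong s (ℕ.+-suc n i)))

  X^_-X : ℕ → Poly
  X^ n -X = mono n ⊞ (⊟ X)

  act-X^n-X : ∀ n s i → act (X^ n -X) s i ≡ s (n ℕ.+ i) - s (suc i)
  act-X^n-X n s i = trans (act-⊞ (mono n) (⊟ X) s i) (cong₂ _+_ (act-mono n s i) (trans (act-⊟ X s i) (cong -_ (act-X s i))))

  -- The lower term reads position `i + 1`, which lies in the window of zeros because `n` is at
  -- least 2.
  X^n-X-leads : ∀ {n} → 2 ≤ n → Leads n (X^ n -X)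
  X^n-X-leads {n} 2≤n s i s≡0 = begin
    act (X^ n -X) s i            ≡⟨ act-X^n-X n s i ⟩
    s (n ℕ.+ i) - s (suc i)      ≡⟨ cong₂ _-_ (cong s (ℕ.+-comm n i)) (trans (cong s (sym (ℕ.+-comm i 1))) (s≡0 1 2≤n)) ⟩
    s (i ℕ.+ n) - 0#             ≡⟨ cong (s (i ℕ.+ n) +_) (sym (+-identityˡ _)) ⟩
    s (i ℕ.+ n) + (0# - 0#)      ≡⟨ cong (s (i ℕ.+ n) +_) (-‿inverseʳ 0#) ⟩
    s (i ℕ.+ n) + 0#             ≡⟨ +-identityʳ _ ⟩
    s (i ℕ.+ n)                  ∎
    where open ≡-Reasoning

  module Periodic (r : ℕ) .{{_ : NonZero r}} where

    HasPeriod : Seq → Set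
    HasPeriod t = ∀ i → t (i ℕ.+ r) ≡ t i

    act-hasPeriod : ∀ a {t} → HasPeriod t → HasPeriod (act a t)
    act-hasPeriod []      per i = refl
    act-hasPeriod (c ∷ a) per i = cong₂ _+_ (cong (c *_) (per i)) (act-hasPeriod a per (suc i))

    period-multiple : ∀ {t} → HasPeriod t → ∀ i n → t (i ℕ.+ n ℕ.* r) ≡ t i
    period-multiple {t} per i zero    = cong t (ℕ.+-identityʳ i)
    period-multiple {t} per i (suc n) = trans (cong t (trans (cong (i ℕ.+_) (ℕ.+-comm r (n ℕ.* r))) (sym (ℕ.+-assoc i (n ℕ.* r) r))))
      (trans (per (i ℕ.+ n ℕ.* r)) (period-multiple per i n))

    -- A sequence of period `r` is represented by one cycle, so that the search for a minimal
    -- recurrence runs over a finite type.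
    cycle : Vec F r → Seq
    cycle v i = lookup v (i mod r)

    toℕ-mod : ∀ i → toℕ (i mod r) ≡ i % r
    toℕ-mod i = Fin.toℕ-fromℕ< (m%n<n i r)

    cycle-hasPeriod : ∀ v → HasPeriod (cycle v)
    cycle-hasPeriod v i = cong (lookup v) (Fin.fromℕ<-cong _ _ ([m+n]%n≡m%n i r) _ _)

    oneCycle : Seq → Vec F r
    oneCycle t = tabulate (t ∘ toℕ)

    cycle-oneCycle-% : ∀ t i → cycle (oneCycle t) i ≡ t (i % r)
    cycle-oneCycle-% t i = trans (lookup∘tabulate (t ∘ toℕ) (i mod r)) (cong t (toℕ-mod i))

    %-period : ∀ {t} → HasPeriod t → ∀ i → t (i % r) ≡ t i
    %-period {t} per i = trans (sym (period-multiple per (i % r) (i / r))) (cong t (sym (m≡m%n+[m/n]*n i r)))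

    cycle-oneCycle : ∀ {t} → HasPeriod t → ∀ i → cycle (oneCycle t) i ≡ t i
    cycle-oneCycle {t} per i = trans (cycle-oneCycle-% t i) (%-period per i)

    agree-on-cycle : ∀ {s t} → HasPeriod s → HasPeriod t → (∀ (j : Fin r) → s (toℕ j) ≡ t (toℕ j)) → ∀ i → s i ≡ t i
    agree-on-cycle {s} {t} ps pt eq i = begin
      s i                ≡⟨ %-period ps i ⟨
      s (i % r)          ≡⟨ cong s (toℕ-mod i) ⟨
      s (toℕ (i mod r))  ≡⟨ eq (i mod r) ⟩
      t (toℕ (i mod r))  ≡⟨ cong t (toℕ-mod i) ⟩
      t (i % r)          ≡⟨ %-period pt i ⟩
      t i                ∎
      where open ≡-Reasoning

    periodic-≗? : ∀ {s t} → HasPeriod s → HasPeriod t → Dec (∀ i → s i ≡ t i)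
    periodic-≗? {s} {t} ps pt = map′ (agree-on-cycle ps pt) (λ eq j → eq (toℕ j)) (Fin.all? (λ j → s (toℕ j) ≟ t (toℕ j)))

  open import Algebra.Properties.Semiring.Mult semiring using () renaming (_×_ to _·_)

  module PrimeField {p} (pr : Prime p) (F↔Fin : F ↔ Fin p) (char : p · 1# ≡ 0#) (prime : ∀ c → ∃[ n ] c ≡ n · 1#) where

    module PolyFrobenius (v : Seq) where
      open At v
      open CommutativeRing polyRing using (commutativeSemiring)
        renaming (setoid to polySetoid; semiring to polySemiring; sym to ≈-sym; refl to ≈-refl; +-congˡ to ⊞-congˡ)
      open import Algebra.Properties.Semiring.Exp polySemiring
      open import Algebra.Properties.CommutativeSemiring.Exp commutativeSemiring using (^-distrib-*)
      open import Algebra.Properties.Semiring.Mult polySemiring using () renaming (_×_ to _·ᴾ_)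
      open import Relation.Binary.Reasoning.Setoid polySetoid
      open Frobenius polyRing

      ·1-const : ∀ n → n ·ᴾ const 1# ≈ const (n · 1#)
      ·1-const zero    = ⟪ (λ i → sym (trans (act-const 0# v i) (zeroˡ _))) ⟫
      ·1-const (suc n) = ⊞-congˡ {const 1#} (·1-const n)

      charᴾ : p ·ᴾ const 1# ≈ []
      charᴾ = ≈-trans (·1-const p) ⟪ (λ i → trans (act-const _ v i) (trans (cong (_* v i) char) (zeroˡ _))) ⟫

      frob : ℕ → Poly → Poly
      frob e a = a ^ (p ℕ.^ e)

      frob-⊞ : ∀ e a b → frob e (a ⊞ b) ≈ frob e a ⊞ frob e b
      frob-⊞ = ^pᵉ-homo-+ pr charᴾ

      frob-⊠ : ∀ e a b → frob e (a ⊠ b) ≈ frob e a ⊠ frob e b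
      frob-⊠ e a b = ^-distrib-* a b (p ℕ.^ e)

      1^n : ∀ n → const 1# ^ n ≈ const 1#
      1^n zero    = ≈-refl
      1^n (suc n) = ≈-trans (⊠-identityˡ _) (1^n n)

      0^n : ∀ n → 0 < n → [] ^ n ≈ []
      0^n (suc n) _ = ≈-refl

      pᵉ>0 : ∀ e → 0 < p ℕ.^ e
      pᵉ>0 e = ℕ.m^n>0 p e
        where instance _ = ℕ.>-nonZero (ℕ.<-trans (s≤s z≤n) (ℕ.nonTrivial⇒n>1 p {{prime⇒nonTrivial pr}}))

      frob-0 : ∀ e → frob e [] ≈ []
      frob-0 e = 0^n (p ℕ.^ e) (pᵉ>0 e)

      frob-·1 : ∀ e n → frob e (n ·ᴾ const 1#) ≈ n ·ᴾ const 1#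
      frob-·1 e zero    = frob-0 e
      frob-·1 e (suc n) = ≈-trans (frob-⊞ e (const 1#) (n ·ᴾ const 1#)) (⊞-cong (1^n (p ℕ.^ e)) (frob-·1 e n))

      -- Fermat's little theorem: a constant is a sum of ones, and `frob e` is additive and fixes
      -- `const 1#`.
      frob-const : ∀ e c → frob e (const c) ≈ const c
      frob-const e c with n , refl ← prime c = begin
        frob e (const (n · 1#))      ≈⟨ ^-congˡ (p ℕ.^ e) (·1-const n) ⟨
        frob e (n ·ᴾ const 1#)       ≈⟨ frob-·1 e n ⟩
        n ·ᴾ const 1#                ≈⟨ ·1-const n ⟩
        const (n · 1#)               ∎

      ∷-≈ : ∀ c a → c ∷ a ≈ const c ⊞ X ⊠ a
      ∷-≈ c a = ⟪ act-∷ c a v ⟫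

      -- `frob e` is a ring homomorphism fixing the constants, hence determined by its value at `X`.
      -- For `e = k` this is the law a^q = a.
      frob-fixes : ∀ e → frob e X ≈ X → ∀ a → frob e a ≈ a
      frob-fixes e fX []      = frob-0 e
      frob-fixes e fX (c ∷ a) = begin
        frob e (c ∷ a)                         ≈⟨ ^-congˡ (p ℕ.^ e) (∷-≈ c a) ⟩
        frob e (const c ⊞ X ⊠ a)               ≈⟨ frob-⊞ e (const c) (X ⊠ a) ⟩
        frob e (const c) ⊞ frob e (X ⊠ a)      ≈⟨ ⊞-cong (frob-const e c) (frob-⊠ e X a) ⟩
        const c ⊞ frob e X ⊠ frob e a          ≈⟨ ⊞-congˡ {const c} (⊠-cong fX (frob-fixes e fX a)) ⟩
        const c ⊞ X ⊠ a                        ≈⟨ ∷-≈ c a ⟨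
        c ∷ a                                  ∎

      ev : ∀ {d} → Vec F d → Poly → Poly
      ev []      x = []
      ev (c ∷ f) x = const c ⊞ x ⊠ ev f x

      -- The coefficients of `f` are fixed by Frobenius, so a root of the recurrence polynomial is
      -- carried to a root. This produces the conjugates of `X`.
      frob-ev : ∀ e {d} (f : Vec F d) x → frob e (ev f x) ≈ ev f (frob e x)
      frob-ev e []      x = frob-0 e
      frob-ev e (c ∷ f) x = begin
        frob e (const c ⊞ x ⊠ ev f x)                ≈⟨ frob-⊞ e (const c) (x ⊠ ev f x) ⟩
        frob e (const c) ⊞ frob e (x ⊠ ev f x)       ≈⟨ ⊞-cong (frob-const e c) (frob-⊠ e x (ev f x)) ⟩
        const c ⊞ frob e x ⊠ frob e (ev f x)         ≈⟨ ⊞-congˡ {const c} (⊠-congˡ {frob e x} (frob-ev e f x)) ⟩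
        const c ⊞ frob e x ⊠ ev f (frob e x)         ∎

      ev-X : ∀ {d} (f : Vec F d) → ev f X ≈ toList f
      ev-X []      = ≈-refl
      ev-X (c ∷ f) = ≈-trans (⊞-congˡ {const c} (⊠-congˡ {X} (ev-X f))) (≈-sym (∷-≈ c (toList f)))

      X^n≈mono : ∀ n → X ^ n ≈ mono n
      X^n≈mono zero    = ≈-refl
      X^n≈mono (suc n) = ≈-trans (⊠-congˡ {X} (X^n≈mono n)) ⟪ (λ i → trans (act-⊠ X (mono n) v i) (trans (act-X (act (mono n) v) i) (sym (act-0∷ (mono n) v i)))) ⟫

    1<p : 1 < p
    1<p = ℕ.nonTrivial⇒n>1 p {{prime⇒nonTrivial pr}}

    2≤p^suc : ∀ n → 2 ≤ p ℕ.^ suc n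
    2≤p^suc n = ℕ.≤-trans 1<p (ℕ.m≤m*n p (p ℕ.^ n) {{ℕ.m^n≢0 p n {{ℕ.>-nonZero (ℕ.<-trans (s≤s z≤n) 1<p)}}}})

    frobeniusProduct : ℕ → Poly
    frobeniusProduct zero    = const 1#
    frobeniusProduct (suc n) = X^ p ℕ.^ suc n -X ⊠ frobeniusProduct n

    productDegree : ℕ → ℕ
    productDegree zero    = 0
    productDegree (suc n) = p ℕ.^ suc n ℕ.+ productDegree n

    frobeniusProduct-leads : ∀ n → Leads (productDegree n) (frobeniusProduct n)
    frobeniusProduct-leads zero    = 1-leads
    frobeniusProduct-leads (suc n) = ⊠-leads {p ℕ.^ suc n} {productDegree n} {X^ p ℕ.^ suc n -X} {frobeniusProduct n}
      (X^n-X-leads (2≤p^suc n)) (frobeniusProduct-leads n)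

    -- The slack 2 is what gives `D < r` at `n = k′`, where the bound is `q = r + 1`. In the
    -- induction one more factor `p` pays for the doubling of `p ^ suc n`.
    productDegree-bound : ∀ n → 2 ℕ.+ productDegree n ≤ p ℕ.^ suc n
    productDegree-bound zero    = 2≤p^suc 0
    productDegree-bound (suc n) = begin
      2 ℕ.+ (p ℕ.^ suc n ℕ.+ productDegree n)     ≡⟨ ℕ.+-assoc 2 (p ℕ.^ suc n) _ ⟨
      2 ℕ.+ p ℕ.^ suc n ℕ.+ productDegree n       ≡⟨ cong (ℕ._+ productDegree n) (ℕ.+-comm 2 (p ℕ.^ suc n)) ⟩
      p ℕ.^ suc n ℕ.+ 2 ℕ.+ productDegree n       ≡⟨ ℕ.+-assoc (p ℕ.^ suc n) 2 _ ⟩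
      p ℕ.^ suc n ℕ.+ (2 ℕ.+ productDegree n)     ≤⟨ ℕ.+-monoʳ-≤ (p ℕ.^ suc n) (productDegree-bound n) ⟩
      p ℕ.^ suc n ℕ.+ p ℕ.^ suc n                 ≡⟨ cong (p ℕ.^ suc n ℕ.+_) (ℕ.+-identityʳ _) ⟨
      2 ℕ.* p ℕ.^ suc n                           ≤⟨ ℕ.*-monoˡ-≤ (p ℕ.^ suc n) 1<p ⟩
      p ℕ.* p ℕ.^ suc n                           ∎
      where open ℕ.≤-Reasoning

    factor-divides : ∀ n e → 0 < e → e ≤ n → ∃[ b ] (∀ v → let open At v in frobeniusProduct n ≈ b ⊠ X^ p ℕ.^ e -X)
    factor-divides zero    e 0<e e≤0 = contradiction (ℕ.<-≤-trans 0<e e≤0) (λ ())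
    factor-divides (suc n) e 0<e e≤1+n with ℕ.m≤n⇒m<n∨m≡n e≤1+n
    ... | inj₂ refl = frobeniusProduct n , λ v → At.⊠-comm v (X^ p ℕ.^ suc n -X) (frobeniusProduct n)
    ... | inj₁ (s≤s e≤n) with b , eq ← factor-divides n e 0<e e≤n = X^ p ℕ.^ suc n -X ⊠ b , λ v →
      At.≈-trans v (At.⊠-congˡ v {X^ p ℕ.^ suc n -X} (eq v))
        (CommutativeRing.sym (At.polyRing v) (CommutativeRing.*-assoc (At.polyRing v) (X^ p ℕ.^ suc n -X) b (X^ p ℕ.^ e -X)))

    -- A nonzero sequence in the image of g with a recurrence of least order.

    module Construct (k′ r : ℕ) .{{_ : NonZero r}} (q≡1+r : p ℕ.^ suc k′ ≡ suc r) where
      open Periodic r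

      k q D : ℕ
      k = suc k′
      q = p ℕ.^ k
      D = productDegree k′

      g : Poly
      g = frobeniusProduct k′

      D<r : D < r
      D<r = ℕ.s≤s⁻¹ (subst (2 ℕ.+ D ≤_) q≡1+r (productDegree-bound k′))

      δ : ℕ → F
      δ j with j ℕ.≟ D
      ... | yes _ = 1#
      ... | no  _ = 0#

      δ-D : δ D ≡ 1#
      δ-D with D ℕ.≟ D
      ... | yes _ = refl
      ... | no ¬p = contradiction refl ¬p

      δ-< : ∀ j → j < D → δ j ≡ 0#
      δ-< j j<D with j ℕ.≟ D
      ... | yes refl = contradiction j<D (ℕ.<-irrefl refl)
      ... | no _ = refl

      seed : Vec F r
      seed = oneCycle δ

      cycle-seed : ∀ j → j < r → cycle seed j ≡ δ j
      cycle-seed j j<r = trans (cycle-oneCycle-% δ j) (cong δ (m<n⇒m%n≡m j<r))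

      -- The seed is a unit impulse at position `D`, from which the monic `g` of degree `D` reads
      -- its leading coefficient at position 0. By `D < r` the impulse and the zeros before it fit
      -- into one cycle.
      g·seed≢0 : act g (cycle seed) 0 ≢ 0#
      g·seed≢0 eq = 1≢0 (begin
        1#                     ≡⟨ δ-D ⟨
        δ D                    ≡⟨ cycle-seed D D<r ⟨
        cycle seed D           ≡⟨ frobeniusProduct-leads k′ (cycle seed) 0
                                   (λ j j<D → trans (cycle-seed j (ℕ.<-trans j<D D<r)) (δ-< j j<D)) ⟨
        act g (cycle seed) 0   ≡⟨ eq ⟩
        0#                     ∎)
        where open ≡-Reasoning

      image : Vec F r → Seq
      image v = act g (cycle v)

      image-hasPeriod : ∀ v → HasPeriod (image v)
      image-hasPeriod v = act-hasPeriod g (cycle-hasPeriod v)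

      -- The preimage `v` is quantified, not the sequence `image v`: membership in the image of `g`
      -- then needs no test, and both `v` and `c` range over finite types.
      Attains : ℕ → Set
      Attains e = ∃[ v ] (∃[ c ] Recurs {e} c (image v)) × ¬ (∀ i → image v i ≡ 0#)

      0-hasPeriod : HasPeriod (λ _ → 0#)
      0-hasPeriod _ = refl

      attains? : ∀ e → Dec (Attains e)
      attains? e = ∃? (Vec↔Fin F↔Fin r) λ v →
        ∃? (Vec↔Fin F↔Fin e) (λ c → periodic-≗? {λ i → image v (i ℕ.+ e)} {actⱽ c (image v)}
          (λ i → trans (cong (image v) (trans (ℕ.+-assoc i r e) (trans (cong (i ℕ.+_) (ℕ.+-comm r e)) (sym (ℕ.+-assoc i e r)))))
                       (image-hasPeriod v (i ℕ.+ e)))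
          (act-hasPeriod (toList c) (image-hasPeriod v)))
        ×-dec ¬? (periodic-≗? (image-hasPeriod v) 0-hasPeriod)

      -- Periodicity is itself the recurrence X^r = 1; it starts the descent to the least order.
      periodic-recurs : ∀ {t} m → HasPeriod t → m ≡ r → ∃[ c ] Recurs {m} c t
      periodic-recurs zero per refl = contradiction refl (ℕ.≢-nonZero⁻¹ r)
      periodic-recurs {t} (suc m) per refl = 1# ∷ 0ⱽ , λ i → sym (begin
        1# * t i + actⱽ (0ⱽ {m}) t (suc i)  ≡⟨ cong₂ _+_ (*-identityˡ _) (actⱽ-0 m t (suc i)) ⟩
        t i + 0#                            ≡⟨ +-identityʳ _ ⟩
        t i                                 ≡⟨ per i ⟨
        t (i ℕ.+ suc m)                     ∎)
        where open ≡-Reasoning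

      attains-r : Attains r
      attains-r = seed , periodic-recurs r (image-hasPeriod seed) refl , λ eq → g·seed≢0 (eq 0)

      minimal : ∃[ d ] Attains d × (∀ e → e < d → ¬ Attains e)
      minimal = least attains? r attains-r

      -- As `q` is `r + 1`, shifting a sequence of period `r` by `q` is shifting it by one.
      X^q≈X : ∀ {t} → HasPeriod t → At._≈_ t (PolyFrobenius.frob t k X) X
      X^q≈X {t} per = ≈-trans (X^n≈mono q) ⟪ (λ i → begin
        act (mono q) t i       ≡⟨ act-mono q t i ⟩
        t (q ℕ.+ i)            ≡⟨ cong t (trans (cong (ℕ._+ i) q≡1+r) (cong suc (ℕ.+-comm r i))) ⟩
        t (suc i ℕ.+ r)        ≡⟨ per (suc i) ⟩
        t (suc i)              ≡⟨ act-X t i ⟨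
        act X t i              ∎) ⟫
        where
        open At t
        open PolyFrobenius t
        open ≡-Reasoning

      q≥2 : 2 ≤ q
      q≥2 = 2≤p^suc k′

      -- g² v = 0 would give g v = g^q v = 0.
      square-zero⇒zero : ∀ v → let open At (cycle v) in g ⊠ g ≈ [] → g ≈ []
      square-zero⇒zero v gg≈0 = ≈-trans (≈-sym (frob-fixes k (X^q≈X (cycle-hasPeriod v)) g)) (powers q q≥2)
        where
        open At (cycle v)
        open PolyFrobenius (cycle v)
        open CommutativeRing polyRing using () renaming (sym to ≈-sym; refl to ≈-refl; *-assoc to ⊠-assoc; semiring to polySemiring)
        open import Algebra.Properties.Semiring.Exp polySemiring
        powers : ∀ n → 2 ≤ n → g ^ n ≈ []
        powers (suc zero) (s≤s ())
        powers (suc (suc n)) _ = ≈-trans (≈-sym (⊠-assoc g g (g ^ n))) (⊠-cong {_} {_} {g ^ n} gg≈0 ≈-refl)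

      -- The polynomials modulo the annihilator of w form a field of pᵏ elements.

      module Minimal {d} (v : Vec F r) (f : Vec F d) (rec : Recurs f (image v)) (w≢0 : ¬ (∀ i → image v i ≡ 0#))
        (min : ∀ e → e < d → ¬ Attains e) where

        w : Seq
        w = image v

        open At w
        open CommutativeRing polyRing using ()
          renaming (setoid to polySetoid; semiring to polySemiring; sym to ≈-sym; refl to ≈-refl; +-congˡ to ⊞-congˡ)
        open PolyFrobenius w
        open import Algebra.Properties.Semiring.Exp polySemiring

        1≉0 : ¬ const 1# ≈ []
        1≉0 eq = w≢0 (λ i → trans (sym (act-1 w i)) (at eq i))

        -- Since `b` commutes with `g`, the sequence `act b w` is again in the image of `g`.
        -- Minimality of `d` thus applies to every nonzero multiple of `w`.
        multiple-attains : ∀ b {e} (c : Vec F e) → Recurs c (act b w) → ¬ (∀ i → act b w i ≡ 0#) → Attains e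
        multiple-attains b {e} c rec′ ≢0 = v′ , (c , λ i → begin
            image v′ (i ℕ.+ e)   ≡⟨ image≡ (i ℕ.+ e) ⟩
            act b w (i ℕ.+ e)    ≡⟨ rec′ i ⟩
            actⱽ c (act b w) i   ≡⟨ act-cong (toList c) image≡ i ⟨
            actⱽ c (image v′) i  ∎) , λ eq → ≢0 (λ i → trans (sym (image≡ i)) (eq i))
          where
          open ≡-Reasoning
          v′ = oneCycle (act b (cycle v))
          image≡ : ∀ i → image v′ i ≡ act b w i
          image≡ i = trans (act-cong g (cycle-oneCycle (act-hasPeriod b (cycle-hasPeriod v))) i) (act-comm g b (cycle v) i)

        -- A nonzero `u` killing the nonzero sequence `act b w` would give that sequence a
        -- recurrence of order below `d`. With `b` equal to one this is linear independence of the
        -- powers of `X`; for general `b` it excludes zero divisors.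
        independent : ∀ (u : Vec F d) b → ¬ b ≈ [] → toList u ⊠ b ≈ [] → u ≡ 0ⱽ
        independent u b b≉0 ub≈0 with ≡-dec _≟_ u 0ⱽ
        ... | yes u≡0 = u≡0
        ... | no u≢0 with e , e<d , c , rec′ ← annihilated⇒recurs u (act b w) u≢0 (λ i → trans (sym (act-⊠ (toList u) b w i)) (at ub≈0 i))
          = contradiction (multiple-attains b c rec′ (λ eq → b≉0 ⟪ eq ⟫)) (min e e<d)

        rem : Poly → Vec F d
        rem a = proj₁ (reduce f rec a)

        rem-≈ : ∀ a → a ≈ toList (rem a)
        rem-≈ a = ⟪ proj₂ (reduce f rec a) ⟫

        ⊞≈ : ∀ (u u′ : Vec F d) → toList (u ⊞ⱽ u′) ≈ toList u ⊞ toList u′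
        ⊞≈ u u′ = ⟪ (λ i → trans (actⱽ-⊞ⱽ u u′ w i) (sym (act-⊞ (toList u) (toList u′) w i))) ⟫

        -- The factor `a` may be replaced by its remainder, which has `d` coefficients and so falls
        -- under `independent` once `b` is nonzero.
        polyDomain : ∀ a b → a ⊠ b ≈ [] → a ≈ [] ⊎ b ≈ []
        polyDomain a b ab≈0 with periodic-≗? (act-hasPeriod b (image-hasPeriod v)) 0-hasPeriod
        ... | yes b≈0 = inj₂ ⟪ b≈0 ⟫
        ... | no b≉0 = inj₁ (≈-trans (rem-≈ a) ⟪ (λ i → trans (cong (λ u → actⱽ u w i) rem≡0) (actⱽ-0 d w i)) ⟫)
          where
          rem≡0 : rem a ≡ 0ⱽ
          rem≡0 = independent (rem a) b (b≉0 ∘ at) (≈-trans (⊠-cong {_} {_} {b} {b} (≈-sym (rem-≈ a)) ≈-refl) ab≈0)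

        toList-injective : ∀ (u u′ : Vec F d) → toList u ≈ toList u′ → u ≡ u′
        toList-injective u u′ eq = pointwise u u′ (independent (u ⊞ⱽ Vec.map -_ u′) (const 1#) 1≉0
          ⟪ (λ i → trans (act-⊠ (toList (u ⊞ⱽ Vec.map -_ u′)) (const 1#) w i) (trans (act-cong (toList (u ⊞ⱽ Vec.map -_ u′)) (act-1 w) i) (begin
            actⱽ (u ⊞ⱽ Vec.map -_ u′) w i               ≡⟨ actⱽ-⊞ⱽ u _ w i ⟩
            actⱽ u w i + actⱽ (Vec.map -_ u′) w i      ≡⟨ cong₂ _+_ (at eq i) (trans (cong (λ a → act a w i) (toList-map -_ u′)) (act-⊟ (toList u′) w i)) ⟩
            actⱽ u′ w i - actⱽ u′ w i                  ≡⟨ -‿inverseʳ _ ⟩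
            0#                                         ∎))) ⟫)
          where
          open ≡-Reasoning
          pointwise : ∀ {n} (u u′ : Vec F n) → u ⊞ⱽ Vec.map -_ u′ ≡ 0ⱽ → u ≡ u′
          pointwise []      []        _  = refl
          pointwise (c ∷ u) (c′ ∷ u′) eq = cong₂ _∷_ (x∙y⁻¹≈ε⇒x≈y c c′ (cong Vec.head eq)) (pointwise u u′ (cong Vec.tail eq))

        -- `g` is a multiple of this factor, so a factor killing `w = g v` would make g² v vanish,
        -- and then `w` by `square-zero⇒zero`.
        factor≉0 : ∀ e → 0 < e → e < k → ¬ X^ p ℕ.^ e -X ≈ []
        factor≉0 e 0<e (s≤s e≤k′) h≈0 = w≢0 (At.at (square-zero⇒zero v gg≈0))
          where
          open ≡-Reasoning
          h = X^ p ℕ.^ e -X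
          b = proj₁ (factor-divides k′ e 0<e e≤k′)
          gg≈0 : At._≈_ (cycle v) (g ⊠ g) []
          gg≈0 = At.⟪ (λ i → begin
            act (g ⊠ g) (cycle v) i          ≡⟨ act-⊠ g g (cycle v) i ⟩
            act g w i                        ≡⟨ act-comm g g (cycle v) i ⟩
            act g w i                        ≡⟨ At.at (proj₂ (factor-divides k′ e 0<e e≤k′) w) i ⟩
            act (b ⊠ h) w i                  ≡⟨ act-⊠ b h w i ⟩
            act b (act h w) i                ≡⟨ act-cong b (at h≈0) i ⟩
            act b (λ _ → 0#) i               ≡⟨ act-0ˢ b i ⟩
            0#                               ∎) ⟫

        X^pᵉ≉X : ∀ e → 0 < e → e < k → ¬ frob e X ≈ X
        X^pᵉ≉X e 0<e e<k eq = factor≉0 e 0<e e<k ⟪ (λ i → begin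
          act (X^ p ℕ.^ e -X) w i                    ≡⟨ act-⊞ (mono (p ℕ.^ e)) (⊟ X) w i ⟩
          act (mono (p ℕ.^ e)) w i + act (⊟ X) w i   ≡⟨ cong₂ _+_ (at (≈-trans (≈-sym (X^n≈mono (p ℕ.^ e))) eq) i) (act-⊟ X w i) ⟩
          act X w i - act X w i                      ≡⟨ -‿inverseʳ _ ⟩
          0#                                         ∎) ⟫
          where open ≡-Reasoning

        -- Raise an equality of the two conjugates to the power p^(k-i). One side becomes X^q, which
        -- is X; the other becomes X^q raised to p^(j-i), which is `frob (j ∸ i) X`. But 0 < j - i <
        -- k.
        frob-X-distinct : ∀ {i j} → i < j → j < k → ¬ frob i X ≈ frob j X
        frob-X-distinct {i} {j} i<j j<k eq = X^pᵉ≉X (j ∸ i) (ℕ.m<n⇒0<n∸m i<j) (ℕ.≤-<-trans (ℕ.m∸n≤m j i) j<k) (begin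
          frob (j ∸ i) X                        ≈⟨ ^-congˡ (p ℕ.^ (j ∸ i)) (X^q≈X (image-hasPeriod v)) ⟨
          (X ^ q) ^ (p ℕ.^ (j ∸ i))             ≈⟨ ^-assocʳ X q (p ℕ.^ (j ∸ i)) ⟩
          X ^ (q ℕ.* p ℕ.^ (j ∸ i))             ≡⟨ cong (X ^_) exponents ⟩
          X ^ (p ℕ.^ j ℕ.* p ℕ.^ (k ∸ i))       ≈⟨ ^-assocʳ X (p ℕ.^ j) (p ℕ.^ (k ∸ i)) ⟨
          frob (k ∸ i) (frob j X)               ≈⟨ ^-congˡ (p ℕ.^ (k ∸ i)) eq ⟨
          frob (k ∸ i) (frob i X)               ≈⟨ ^-assocʳ X (p ℕ.^ i) (p ℕ.^ (k ∸ i)) ⟩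
          X ^ (p ℕ.^ i ℕ.* p ℕ.^ (k ∸ i))       ≡⟨ cong (X ^_) (trans (sym (ℕ.^-distribˡ-+-* p i (k ∸ i))) (cong (p ℕ.^_) (ℕ.m+[n∸m]≡n i≤k))) ⟩
          X ^ q                                 ≈⟨ X^q≈X (image-hasPeriod v) ⟩
          X                                     ∎)
          where
          open import Relation.Binary.Reasoning.Setoid polySetoid
          i≤k : i ≤ k
          i≤k = ℕ.<⇒≤ (ℕ.<-trans i<j j<k)
          exponents : q ℕ.* p ℕ.^ (j ∸ i) ≡ p ℕ.^ j ℕ.* p ℕ.^ (k ∸ i)
          exponents = trans (sym (ℕ.^-distribˡ-+-* p k (j ∸ i))) (trans (cong (p ℕ.^_)
            (trans (ℕ.+-comm k (j ∸ i)) (trans (sym (ℕ.+-∸-comm k (ℕ.<⇒≤ i<j))) (ℕ.+-∸-assoc j i≤k)))) (ℕ.^-distribˡ-+-* p j (k ∸ i)))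

        open MonicRoots polyRing

        characteristic : Poly → Poly
        characteristic x = x ^ d ⊞ ⊟ ev f x

        k≤d : k ≤ d
        k≤d = roots≤degree polyDomain 1≉0 (monic f) (λ i → frob (toℕ i) X) distinct root
          where
          distinct : ∀ (i j : Fin k) → frob (toℕ i) X ≈ frob (toℕ j) X → i ≡ j
          distinct i j eq with ℕ.<-cmp (toℕ i) (toℕ j)
          ... | tri< i<j _ _ = contradiction eq (frob-X-distinct i<j (Fin.toℕ<n j))
          ... | tri≈ _ i≡j _ = Fin.toℕ-injective i≡j
          ... | tri> _ _ j<i = contradiction (≈-sym eq) (frob-X-distinct j<i (Fin.toℕ<n i))

          monic : ∀ {n} (f : Vec F n) → Monic n (λ x → x ^ n ⊞ ⊟ ev f x)
          monic []              = one (λ _ → ≈-refl)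
          monic {suc n} (c ∷ f) = horner (⊟ const c) (monic f) (λ x → lemma x)
            where
            open import Relation.Binary.Reasoning.Setoid polySetoid
            open CommutativeRing polyRing using () renaming (+-assoc to ⊞-assoc)
            open import Algebra.Properties.AbelianGroup (CommutativeRing.+-abelianGroup polyRing) using () renaming (⁻¹-∙-comm to ⊟-⊞-comm)
            open import Algebra.Properties.Ring (CommutativeRing.ring polyRing) using () renaming (-‿distribʳ-* to ⊟-distribʳ-⊠)
            lemma : ∀ x → x ⊠ x ^ n ⊞ ⊟ (const c ⊞ x ⊠ ev f x) ≈ ⊟ const c ⊞ x ⊠ (x ^ n ⊞ ⊟ ev f x)
            lemma x = begin
              x ⊠ x ^ n ⊞ ⊟ (const c ⊞ x ⊠ ev f x)        ≈⟨ ⊞-congˡ {x ⊠ x ^ n} (≈-sym (⊟-⊞-comm (const c) (x ⊠ ev f x))) ⟩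
              x ⊠ x ^ n ⊞ (⊟ const c ⊞ ⊟ (x ⊠ ev f x))    ≈⟨ ⊞-congˡ {x ⊠ x ^ n} (⊞-comm (⊟ const c) (⊟ (x ⊠ ev f x))) ⟩
              x ⊠ x ^ n ⊞ (⊟ (x ⊠ ev f x) ⊞ ⊟ const c)    ≈⟨ ⊞-assoc (x ⊠ x ^ n) (⊟ (x ⊠ ev f x)) (⊟ const c) ⟨
              x ⊠ x ^ n ⊞ ⊟ (x ⊠ ev f x) ⊞ ⊟ const c      ≈⟨ ⊞-comm (x ⊠ x ^ n ⊞ ⊟ (x ⊠ ev f x)) (⊟ const c) ⟩
              ⊟ const c ⊞ (x ⊠ x ^ n ⊞ ⊟ (x ⊠ ev f x))    ≈⟨ ⊞-congˡ {⊟ const c} (⊞-congˡ {x ⊠ x ^ n} (⊟-distribʳ-⊠ x (ev f x))) ⟩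
              ⊟ const c ⊞ (x ⊠ x ^ n ⊞ x ⊠ (⊟ ev f x))    ≈⟨ ⊞-congˡ {⊟ const c} (⊠-distribˡ x (x ^ n) (⊟ ev f x)) ⟨
              ⊟ const c ⊞ x ⊠ (x ^ n ⊞ ⊟ ev f x)          ∎

          -- The recurrence of `w`, read as an equation in the quotient: `X` is a root of
          -- `characteristic`.
          X^d≈f : X ^ d ≈ ev f X
          X^d≈f = ≈-trans (X^n≈mono d) (≈-trans ⟪ (λ i → trans (act-mono d w i) (trans (cong w (ℕ.+-comm d i)) (rec i))) ⟫ (≈-sym (ev-X f)))

          root : ∀ (i : Fin k) → characteristic (frob (toℕ i) X) ≈ []
          root i = begin
            frob e X ^ d ⊞ ⊟ ev f (frob e X)       ≈⟨ ⊞-cong frob-X^d (⊟-cong (≈-sym (frob-ev e f X))) ⟩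
            frob e (ev f X) ⊞ ⊟ frob e (ev f X)    ≈⟨ ⊟-inverseʳ (frob e (ev f X)) ⟩
            []                                     ∎
            where
            open import Relation.Binary.Reasoning.Setoid polySetoid
            open CommutativeRing polyRing using () renaming (-‿inverseʳ to ⊟-inverseʳ; -‿cong to ⊟-cong)
            e = toℕ i
            frob-X^d : frob e X ^ d ≈ frob e (ev f X)
            frob-X^d = begin
              (X ^ (p ℕ.^ e)) ^ d     ≈⟨ ^-assocʳ X (p ℕ.^ e) d ⟩
              X ^ (p ℕ.^ e ℕ.* d)     ≡⟨ cong (X ^_) (ℕ.*-comm (p ℕ.^ e) d) ⟩
              X ^ (d ℕ.* p ℕ.^ e)     ≈⟨ ^-assocʳ X d (p ℕ.^ e) ⟨
              (X ^ d) ^ (p ℕ.^ e)     ≈⟨ ^-congˡ (p ℕ.^ e) X^d≈f ⟩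
              frob e (ev f X)         ∎

        d≤k : d ≤ k
        d≤k = ℕ.≮⇒≥ (λ k<d → ℕ.<⇒≱ (ℕ.^-monoʳ-< p 1<p k<d) p^d≤q)
          where
          open Inverse (Vec↔Fin F↔Fin d)
          p^d≤q : p ℕ.^ d ≤ q
          p^d≤q = roots≤degree polyDomain 1≉0 (x^n-x-monic q q≥2) (toList ∘ from)
            (λ i j eq → from-injective (Vec↔Fin F↔Fin d) (toList-injective _ _ eq))
            (λ i → ≈-trans (⊞-cong (frob-fixes k (X^q≈X (image-hasPeriod v)) (toList (from i))) ≈-refl) (⊟-inverseʳ (toList (from i))))
            where open CommutativeRing polyRing using () renaming (-‿inverseʳ to ⊟-inverseʳ)

        infixl 7 _⊗_
        _⊗_ : Vec F d → Vec F d → Vec F d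
        u ⊗ u′ = rem (toList u ⊠ toList u′)

        vecRing : RawRing _ _
        vecRing = record { _≈_ = _≡_ ; _+_ = _⊞ⱽ_ ; _*_ = _⊗_ ; -_ = Vec.map -ᶠ_ ; 0# = 0ⱽ ; 1# = rem (const 1#) }

        toList-0ⱽ : toList (0ⱽ {d}) ≈ []
        toList-0ⱽ = ⟪ actⱽ-0 d w ⟫

        -- Remainders represent the classes uniquely, so the ring laws of the vectors are pulled
        -- back from `polyRing` along this embedding.
        toList-isRingMonomorphism : IsRingMonomorphism vecRing (CommutativeRing.rawRing polyRing) toList
        toList-isRingMonomorphism = record
          { isRingHomomorphism = record
            { isSemiringHomomorphism = record
              { isNearSemiringHomomorphism = record
                { +-isMonoidHomomorphism = record
                  { isMagmaHomomorphism = record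
                    { isRelHomomorphism = record { cong = λ { refl → ≈-refl } }
                    ; homo = ⊞≈
                    }
                  ; ε-homo = toList-0ⱽ
                  }
                ; *-homo = λ u u′ → ≈-sym (rem-≈ (toList u ⊠ toList u′))
                }
              ; 1#-homo = ≈-sym (rem-≈ (const 1#))
              }
            ; -‿homo = λ u → ⟪ (λ i → cong (λ a → act a w i) (toList-map -_ u)) ⟫
            }
          ; injective = λ {u} {u′} → toList-injective u u′
          }

        ⊗-isCommutativeRing : IsCommutativeRing _≡_ _⊞ⱽ_ _⊗_ (Vec.map -ᶠ_) 0ⱽ (rem (const 1#))
        ⊗-isCommutativeRing = RingMonomorphism.isCommutativeRing toList-isRingMonomorphism (CommutativeRing.isCommutativeRing polyRing)

        ⊗-domain : ∀ u u′ → u ⊗ u′ ≡ 0ⱽ → u ≡ 0ⱽ ⊎ u′ ≡ 0ⱽ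
        ⊗-domain u u′ uu′≡0 = [ inj₁ ∘ zero⁻¹ u , inj₂ ∘ zero⁻¹ u′ ]′ (polyDomain (toList u) (toList u′)
          (≈-trans (rem-≈ (toList u ⊠ toList u′)) (≈-trans (toList-≡ uu′≡0) toList-0ⱽ)))
          where
          toList-≡ : ∀ {u u′ : Vec F d} → u ≡ u′ → toList u ≈ toList u′
          toList-≡ refl = ≈-refl
          zero⁻¹ : ∀ u → toList u ≈ [] → u ≡ 0ⱽ
          zero⁻¹ u eq = toList-injective u 0ⱽ (≈-trans eq (≈-sym toList-0ⱽ))

        ⊗-1≢0 : rem (const 1#) ≢ 0ⱽ
        ⊗-1≢0 eq = 1≉0 (≈-trans (rem-≈ (const 1#)) ⟪ (λ i → trans (cong (λ u → actⱽ u w i) eq) (actⱽ-0 d w i)) ⟫)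

    -- Addition is fixed to be coordinatewise, because bentness speaks of that group; only a
    -- multiplication has to be supplied.
    record FieldStructure (n : ℕ) : Set where
      infixl 7 _⊗_
      field
        _⊗_ : Vec F n → Vec F n → Vec F n
        1ⱽ  : Vec F n
        ⊗-isCommutativeRing : IsCommutativeRing _≡_ _⊞ⱽ_ _⊗_ (Vec.map -ᶠ_) 0ⱽ 1ⱽ
        ⊗-domain : ∀ u u′ → u ⊗ u′ ≡ 0ⱽ → u ≡ 0ⱽ ⊎ u′ ≡ 0ⱽ
        1ⱽ≢0ⱽ : 1ⱽ ≢ 0ⱽ

    fieldStructure : ∀ n → 0 < n → FieldStructure n
    fieldStructure (suc k′) _ = build minimal
      where
      2≤q = 2≤p^suc k′
      r = ℕ.pred (p ℕ.^ suc k′)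
      0<r : 0 < r
      0<r = ℕ.pred-mono-≤ 2≤q
      instance
        r≢0 : NonZero r
        r≢0 = ℕ.>-nonZero 0<r
      open Construct k′ r (sym (ℕ.suc-pred (p ℕ.^ suc k′) {{ℕ.>-nonZero (ℕ.<-trans (s≤s z≤n) 2≤q)}}))
      build : ∃[ d ] Attains d × (∀ e → e < d → ¬ Attains e) → FieldStructure (suc k′)
      build (d , (v , (f , rec) , w≢0) , min) = subst FieldStructure (ℕ.≤-antisym d≤k k≤d) (record
        { _⊗_ = _⊗_ ; 1ⱽ = rem (const 1#) ; ⊗-isCommutativeRing = ⊗-isCommutativeRing ; ⊗-domain = ⊗-domain ; 1ⱽ≢0ⱽ = ⊗-1≢0 })
        where open Minimal v f rec w≢0 min

-- Cardinalities as sums of indicators.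

-- Iverson bracket.
[_] : {P : Set} → Dec P → ℕ
[ yes _ ] = 1
[ no  _ ] = 0

[]-yes : ∀ {P : Set} (P? : Dec P) → P → [ P? ] ≡ 1
[]-yes (yes _) _ = refl
[]-yes (no ¬p) p = contradiction p ¬p

[]-no : ∀ {P : Set} (P? : Dec P) → ¬ P → [ P? ] ≡ 0
[]-no (yes p) ¬p = contradiction p ¬p
[]-no (no _) _ = refl

[]-cong : ∀ {P Q : Set} (P? : Dec P) (Q? : Dec Q) → (P → Q) → (Q → P) → [ P? ] ≡ [ Q? ]
[]-cong (yes p) Q? f g = sym ([]-yes Q? (f p))
[]-cong (no ¬p) Q? f g = sym ([]-no Q? (¬p ∘ g))

↔⇒≟ : ∀ {A : Set} {N} → A ↔ Fin N → DecidableEquality A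
↔⇒≟ e x y = map′ (λ eq → trans (sym (strictlyInverseʳ x)) (trans (cong from eq) (strictlyInverseʳ y))) (cong to) (to x Fin.≟ to y)
  where open Inverse e

sum-+ : ∀ m {n} (f : Fin (m ℕ.+ n) → ℕ) → sum f ≡ sum (λ i → f (i ↑ˡ n)) ℕ.+ sum (λ j → f (m ↑ʳ j))
sum-+ zero    f = refl
sum-+ (suc m) f = trans (cong (f zero ℕ.+_) (sum-+ m (f ∘ suc))) (sym (ℕ.+-assoc (f zero) _ _))

sum-* : ∀ m {n} (f : Fin (m ℕ.* n) → ℕ) → sum f ≡ sum (λ i → sum (λ j → f (combine {m} i j)))
sum-* zero    f = refl
sum-* (suc m) {n} f = trans (sum-+ n f) (cong (sum (λ i → f (i ↑ˡ (m ℕ.* n))) ℕ.+_) (sum-* m (λ i → f (n ↑ʳ i))))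

sum-const : ∀ n c → sum {n} (λ _ → c) ≡ n ℕ.* c
sum-const zero    c = refl
sum-const (suc n) c = cong (c ℕ.+_) (sum-const n c)

sum-point : ∀ {n} (f : Fin n → ℕ) a → (∀ i → i ≢ a → f i ≡ 0) → sum f ≡ f a
sum-point {suc n} f zero    f≡0 = trans (cong (f zero ℕ.+_) (trans (sum-cong-≗ (λ i → f≡0 (suc i) (λ ()))) (trans (sum-const n 0) (ℕ.*-zeroʳ n)))) (ℕ.+-identityʳ _)
sum-point {suc n} f (suc a) f≡0 = cong₂ ℕ._+_ (f≡0 zero (λ ())) (sum-point (f ∘ suc) a (λ i i≢a → f≡0 (suc i) (i≢a ∘ Fin.suc-injective)))

-- Serves as the principle that a vanishing sum of squares has vanishing terms, in a form free of
-- differences.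
sum-≤-tight : ∀ {n} (f g : Fin n → ℕ) → (∀ i → f i ≤ g i) → sum f ≡ sum g → ∀ i → f i ≡ g i
sum-≤-tight {suc n} f g f≤g eq = λ { zero → head≡ ; (suc i) → sum-≤-tight (f ∘ suc) (g ∘ suc) (f≤g ∘ suc) tail≡ i }
  where
  sum-mono : ∀ {n} {f g : Fin n → ℕ} → (∀ i → f i ≤ g i) → sum f ≤ sum g
  sum-mono {zero}  f≤g = z≤n
  sum-mono {suc n} f≤g = ℕ.+-mono-≤ (f≤g zero) (sum-mono (f≤g ∘ suc))
  head≡ : f zero ≡ g zero
  head≡ = ℕ.≤-antisym (f≤g zero) (ℕ.+-cancelʳ-≤ (sum (f ∘ suc)) _ _ (ℕ.≤-trans (ℕ.+-monoʳ-≤ (g zero) (sum-mono (f≤g ∘ suc))) (ℕ.≤-reflexive (sym eq))))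
  tail≡ : sum (f ∘ suc) ≡ sum (g ∘ suc)
  tail≡ = ℕ.+-cancelˡ-≡ (f zero) _ _ (trans eq (cong (ℕ._+ sum (g ∘ suc)) (sym head≡)))

Fin-subset↔ : ∀ {n} {P : Fin n → Set} (P? : ∀ i → Dec (P i)) → (∀ i → Irrelevant (P i)) → Σ (Fin n) P ↔ Fin (sum (λ i → [ P? i ]))
Fin-subset↔ {zero}  P? irr = mk↔ₛ′ (λ ()) (λ ()) (λ ()) (λ ())
Fin-subset↔ {suc n} {P} P? irr = ↔-trans
  (mk↔ₛ′ (λ { (zero , p) → inj₁ p ; (suc i , p) → inj₂ (i , p) }) (λ { (inj₁ p) → zero , p ; (inj₂ (i , p)) → suc i , p })
    (λ { (inj₁ p) → refl ; (inj₂ _) → refl }) (λ { (zero , p) → refl ; (suc i , p) → refl }))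
  (↔-trans (point (P? zero) (irr zero) ⊎-↔ Fin-subset↔ (P? ∘ suc) (irr ∘ suc)) (↔-sym (Fin.+↔⊎ {[ P? zero ]})))
  where
  point : ∀ {Q : Set} (Q? : Dec Q) → Irrelevant Q → Q ↔ Fin [ Q? ]
  point (yes q) irr = mk↔ₛ′ (λ _ → zero) (λ _ → q) (λ { zero → refl }) (λ q′ → irr q q′)
  point (no ¬q) irr = mk↔ₛ′ (λ q → contradiction q ¬q) (λ ()) (λ ()) (λ q → contradiction q ¬q)

module _ {A : Set} {N : ℕ} (e : A ↔ Fin N) where
  open Inverse e

  private
    _≟ᵉ_ : DecidableEquality A
    _≟ᵉ_ = ↔⇒≟ e

  opaque
    -- Opaque, since sums over sets of size `p ^ n` are to be rewritten by laws and not evaluated.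
    ∑ : (A → ℕ) → ℕ
    ∑ f = sum (f ∘ from)

    ∑-cong : ∀ {f g} → (∀ x → f x ≡ g x) → ∑ f ≡ ∑ g
    ∑-cong f≡g = sum-cong-≗ (f≡g ∘ from)

    ∑-+ : ∀ (f g : A → ℕ) → ∑ (λ x → f x ℕ.+ g x) ≡ ∑ f ℕ.+ ∑ g
    ∑-+ f g = ∑-distrib-+ (f ∘ from) (g ∘ from)

    ∑-*ˡ : ∀ c (f : A → ℕ) → ∑ (λ x → c ℕ.* f x) ≡ c ℕ.* ∑ f
    ∑-*ˡ c f = sym (*-distribˡ-sum c (f ∘ from))

    ∑-*ʳ : ∀ c (f : A → ℕ) → ∑ (λ x → f x ℕ.* c) ≡ ∑ f ℕ.* c
    ∑-*ʳ c f = trans (∑-cong {λ x → f x ℕ.* c} (λ x → ℕ.*-comm (f x) c)) (trans (∑-*ˡ c f) (ℕ.*-comm c (∑ f)))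

    ∑-const : ∀ c → ∑ (λ _ → c) ≡ N ℕ.* c
    ∑-const = sum-const N

    ∑-point : ∀ f a → (∀ x → x ≢ a → f x ≡ 0) → ∑ f ≡ f a
    ∑-point f a f≡0 = trans (sum-point (f ∘ from) (to a) (λ i i≢ → f≡0 (from i) (λ eq → i≢ (trans (sym (strictlyInverseˡ i)) (cong to eq)))))
      (cong f (strictlyInverseʳ a))

    ∑-≤-tight : ∀ (f g : A → ℕ) → (∀ x → f x ≤ g x) → ∑ f ≡ ∑ g → ∀ x → f x ≡ g x
    ∑-≤-tight f g f≤g eq x = subst (λ y → f y ≡ g y) (strictlyInverseʳ x) (sum-≤-tight (f ∘ from) (g ∘ from) (f≤g ∘ from) eq (to x))

    ∑-δ : ∀ a (f : A → ℕ) → ∑ (λ x → [ x ≟ᵉ a ] ℕ.* f x) ≡ f a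
    ∑-δ a f = trans (∑-point (λ x → [ x ≟ᵉ a ] ℕ.* f x) a (λ x x≢a → cong (ℕ._* f x) ([]-no (x ≟ᵉ a) x≢a)))
      (trans (cong (ℕ._* f a) ([]-yes (a ≟ᵉ a) refl)) (ℕ.*-identityˡ (f a)))

    ∑-δ′ : ∀ a (f : A → ℕ) → ∑ (λ x → [ a ≟ᵉ x ] ℕ.* f x) ≡ f a
    ∑-δ′ a f = trans (∑-cong {λ x → [ a ≟ᵉ x ] ℕ.* f x} (λ x → cong (ℕ._* f x) ([]-cong (a ≟ᵉ x) (x ≟ᵉ a) sym sym))) (∑-δ a f)

    ∑-unique : ∀ {P : A → Set} (P? : ∀ x → Dec (P x)) a → P a → (∀ x → P x → x ≡ a) → ∑ (λ x → [ P? x ]) ≡ 1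
    ∑-unique P? a Pa uniq = trans (∑-point (λ x → [ P? x ]) a (λ x x≢a → []-no (P? x) (x≢a ∘ uniq x))) ([]-yes (P? a) Pa)

    subset↔ : ∀ {P : A → Set} (P? : ∀ x → Dec (P x)) → (∀ x → Irrelevant (P x)) → Σ A P ↔ Fin (∑ (λ x → [ P? x ]))
    subset↔ {P} P? irr = ↔-trans
      (mk↔ₛ′ (λ (x , p) → to x , subst P (sym (strictlyInverseʳ x)) p) (λ (i , p) → from i , p)
        (λ (i , p) → pair≡ (irr ∘ from) (strictlyInverseˡ i)) (λ (x , p) → pair≡ irr (strictlyInverseʳ x)))
      (Fin-subset↔ (P? ∘ from) (irr ∘ from))
      where
      pair≡ : ∀ {B : Set} {Q : B → Set} → (∀ x → Irrelevant (Q x)) → ∀ {x y} {q : Q x} {q′ : Q y} → x ≡ y → (x , q) ≡ (y , q′)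
      pair≡ irr {x} refl = cong (x ,_) (irr x _ _)

module _ {A B : Set} {M N : ℕ} (eA : A ↔ Fin M) (eB : B ↔ Fin N) where
  private
    module A = Inverse eA
    module B = Inverse eB

  _×ᵉ_ : (A × B) ↔ Fin (M ℕ.* N)
  _×ᵉ_ = ↔-trans (eA ×-↔ eB) (↔-sym Fin.*↔×)

  opaque
    unfolding ∑

    ∑-swap : ∀ (f : A → B → ℕ) → ∑ eA (λ a → ∑ eB (f a)) ≡ ∑ eB (λ b → ∑ eA (λ a → f a b))
    ∑-swap f = ∑-comm (λ i j → f (A.from i) (B.from j))

    ∑-reindex : ∀ (σ : A ↔ B) f → ∑ eB f ≡ ∑ eA (f ∘ Inverse.to σ)
    ∑-reindex σ f = trans (sum-permute (f ∘ B.from) (↔-trans (↔-sym eA) (↔-trans σ eB)))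
      (sum-cong-≗ (λ i → cong f (B.strictlyInverseʳ (Inverse.to σ (A.from i)))))

    ∑-× : ∀ (f : A × B → ℕ) → ∑ _×ᵉ_ f ≡ ∑ eA (λ a → ∑ eB (λ b → f (a , b)))
    ∑-× f = trans (sum-* M (f ∘ Inverse.from _×ᵉ_))
      (sum-cong-≗ (λ i → sum-cong-≗ (λ j → cong (λ (i , j) → f (A.from i , B.from j)) (Fin.remQuot-combine {M} i j))))

-- Perfect nonlinear quadratic forms in two variables over a finite field.

module PerfectNonlinearity {K : Set} {_+ᴷ_ _*ᴷ_ : Op₂ K} { -ᴷ_ : Op₁ K} {0ᴷ 1ᴷ : K}
  (isCommutativeRing : IsCommutativeRing _≡_ _+ᴷ_ _*ᴷ_ -ᴷ_ 0ᴷ 1ᴷ)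
  (domain : ∀ x y → (x *ᴷ y) ≡ 0ᴷ → x ≡ 0ᴷ ⊎ y ≡ 0ᴷ) (1≢0 : 1ᴷ ≢ 0ᴷ) {q : ℕ} (e : K ↔ Fin q) where

  R : CommutativeRing _ _
  R = record { isCommutativeRing = isCommutativeRing }

  open CommutativeRing R using (_+_; _*_; -_; _-_; 0#; 1#; ring; +-group; +-comm; +-assoc; +-identityˡ; +-identityʳ; -‿inverseˡ; -‿inverseʳ;
    *-comm; *-identityˡ; *-identityʳ; zeroˡ; zeroʳ; distribʳ)
  open import Algebra.Properties.Group +-group using (x∙y⁻¹≈ε⇒x≈y; ∙-cancelˡ)
  open import Algebra.Properties.Ring ring using (-‿distribˡ-*; -‿distribʳ-*)
  open import Algebra.Solver.Ring.NaturalCoefficients.Default (CommutativeRing.commutativeSemiring R) using (solve; _:+_; _:*_; _:=_)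
  open FiniteDomain isCommutativeRing domain e

  private
    infix 4 _≟_
    _≟_ = ↔⇒≟ e

  K² : Set
  K² = K × K

  e² : K² ↔ Fin (q ℕ.* q)
  e² = e ×ᵉ e

  infixl 6 _+²_
  _+²_ : K² → K² → K²
  (x , y) +² (a , b) = x + a , y + b

  0² : K²
  0² = 0# , 0#

  #_⁻¹_ : (K² → K) → K → ℕ
  # f ⁻¹ w = ∑ e² (λ z → [ f z ≟ w ])

  PerfectNonlinear : (K² → K) → Set
  PerfectNonlinear f = ∀ a → a ≢ 0² → ∀ w → # (λ z → f (z +² a) - f z) ⁻¹ w ≡ q

  +-move : ∀ {x y z} → x + y ≡ z → x ≡ z - y
  +-move {x} {y} refl = sym (trans (+-assoc x y (- y)) (trans (cong (x +_) (-‿inverseʳ y)) (+-identityʳ x)))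

  +-move⁻¹ : ∀ {x y z} → x ≡ z - y → x + y ≡ z
  +-move⁻¹ {x} {y} {z} refl = trans (+-assoc z (- y) y) (trans (cong (z +_) (-‿inverseˡ y)) (+-identityʳ z))

  #x*c≡w : ∀ {c} → c ≢ 0# → ∀ w → ∑ e (λ x → [ x * c ≟ w ]) ≡ 1
  #x*c≡w {c} c≢0 w with x₀ , eq ← divide c≢0 w = ∑-unique e (λ x → x * c ≟ w) x₀ eq (λ x eq′ → *-cancelʳ c≢0 x x₀ (trans eq′ (sym eq)))

  -- A coordinate with nonzero coefficient is determined by the other one, which is free and takes
  -- `q` values.
  affine-fibre : ∀ α β → (α , β) ≢ 0² → ∀ γ w → # (λ (x , y) → (x * α + y * β) + γ) ⁻¹ w ≡ q
  affine-fibre α β αβ≢0 γ w = trans (∑-× e e (λ (x , y) → [ (x * α + y * β) + γ ≟ w ])) (cases (α ≟ 0#) (β ≟ 0#))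
    where
    open ≡-Reasoning
    q*1 : ∑ e (λ _ → 1) ≡ q
    q*1 = trans (∑-const e 1) (ℕ.*-identityʳ q)
    cases : Dec (α ≡ 0#) → Dec (β ≡ 0#) → ∑ e (λ x → ∑ e (λ y → [ (x * α + y * β) + γ ≟ w ])) ≡ q
    cases (yes refl) (yes refl) = contradiction refl αβ≢0
    cases _ (no β≢0) = trans (∑-cong e (λ x → trans
      (∑-cong e (λ y → []-cong ((x * α + y * β) + γ ≟ w) (y * β ≟ (w - γ) - x * α)
        (λ eq → +-move (trans (+-comm (y * β) (x * α)) (+-move eq)))
        (λ eq → +-move⁻¹ (trans (+-comm (x * α) (y * β)) (+-move⁻¹ eq)))))
      (#x*c≡w β≢0 ((w - γ) - x * α)))) q*1
    cases (no α≢0) _ = trans (∑-swap e e (λ x y → [ (x * α + y * β) + γ ≟ w ])) (trans (∑-cong e (λ y → trans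
      (∑-cong e (λ x → []-cong ((x * α + y * β) + γ ≟ w) (x * α ≟ (w - γ) - y * β)
        (λ eq → +-move (+-move eq)) (λ eq → +-move⁻¹ (+-move⁻¹ eq))))
      (#x*c≡w α≢0 ((w - γ) - y * β)))) q*1)

  -- `ℓ a` lists the coefficients of the polar form at `a`. Its trivial kernel is nondegeneracy of
  -- the quadratic form, and makes each derivative in a nonzero direction a nonconstant affine map.
  polar⇒perfect : ∀ f (ℓ : K² → K²) → (∀ a → ℓ a ≡ 0² → a ≡ 0²) →
    (∀ z a → f (z +² a) ≡ f z + ((proj₁ z * proj₁ (ℓ a) + proj₂ z * proj₂ (ℓ a)) + f a)) → PerfectNonlinear f
  polar⇒perfect f ℓ ℓ-inj f-+ a a≢0 w = trans
    (∑-cong e² (λ z → cong (λ v → [ v ≟ w ]) (derivative z)))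
    (affine-fibre (proj₁ (ℓ a)) (proj₂ (ℓ a)) (a≢0 ∘ ℓ-inj a) (f a) w)
    where
    derivative : ∀ z → f (z +² a) - f z ≡ (proj₁ z * proj₁ (ℓ a) + proj₂ z * proj₂ (ℓ a)) + f a
    derivative z = sym (+-move (trans (+-comm _ (f z)) (sym (f-+ z a))))

  product-+ : ∀ x y a b → (x + a) * (y + b) ≡ x * y + ((x * b + y * a) + a * b)
  product-+ = solve 4 (λ x y a b → (x :+ a) :* (y :+ b) := x :* y :+ ((x :* b :+ y :* a) :+ a :* b)) refl

  norm-+ : ∀ d x y a b → (x + a) * (x + a) + (x + a) * (y + b) + d * ((y + b) * (y + b)) ≡
    (x * x + x * y + d * (y * y)) + ((x * (a + a + b) + y * (a + (d * b + d * b))) + (a * a + a * b + d * (b * b)))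
  norm-+ = solve 5 (λ d x y a b → (x :+ a) :* (x :+ a) :+ (x :+ a) :* (y :+ b) :+ d :* ((y :+ b) :* (y :+ b)) :=
    (x :* x :+ x :* y :+ d :* (y :* y)) :+ ((x :* (a :+ a :+ b) :+ y :* (a :+ (d :* b :+ d :* b))) :+ (a :* a :+ a :* b :+ d :* (b :* b)))) refl

  norm-homogeneous : ∀ d t y → (t * y) * (t * y) + (t * y) * y + d * (y * y) ≡ (t * t + t + d) * (y * y)
  norm-homogeneous = solve 3 (λ d t y → (t :* y) :* (t :* y) :+ (t :* y) :* y :+ d :* (y :* y) := (t :* t :+ t :+ d) :* (y :* y)) refl

  norm-double : ∀ d a b → (a * a + a * b + d * (b * b)) + (a * a + a * b + d * (b * b)) ≡ a * (a + a + b) + b * (a + (d * b + d * b))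
  norm-double = solve 3 (λ d a b → (a :* a :+ a :* b :+ d :* (b :* b)) :+ (a :* a :+ a :* b :+ d :* (b :* b)) :=
    a :* (a :+ a :+ b) :+ b :* (a :+ (d :* b :+ d :* b))) refl

  product : K² → K
  product (x , y) = x * y

  product-perfect : PerfectNonlinear product
  product-perfect = polar⇒perfect product (λ (a , b) → b , a) (λ { (a , b) refl → refl }) (λ (x , y) (a , b) → product-+ x y a b)

  -- Counted by rows: a nonzero `x` admits one `y`, while `x = 0` admits all or none. The extra 1,
  -- charged to the row `x = 0`, avoids writing `q - 1`.
  #product : ∀ w → # product ⁻¹ w ℕ.+ 1 ≡ q ℕ.+ [ w ≟ 0# ] ℕ.* q
  #product w = begin
    # product ⁻¹ w ℕ.+ 1
      ≡⟨ cong₂ ℕ._+_ (∑-× e e (λ (x , y) → [ x * y ≟ w ])) (sym (∑-unique e (λ x → x ≟ 0#) 0# refl (λ _ eq → eq))) ⟩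
    ∑ e (λ x → ∑ e (λ y → [ x * y ≟ w ])) ℕ.+ ∑ e (λ x → [ x ≟ 0# ])
      ≡⟨ ∑-+ e _ _ ⟨
    ∑ e (λ x → ∑ e (λ y → [ x * y ≟ w ]) ℕ.+ [ x ≟ 0# ])
      ≡⟨ ∑-cong e row ⟩
    ∑ e (λ x → 1 ℕ.+ [ x ≟ 0# ] ℕ.* ([ w ≟ 0# ] ℕ.* q))
      ≡⟨ ∑-+ e _ _ ⟩
    ∑ e (λ _ → 1) ℕ.+ ∑ e (λ x → [ x ≟ 0# ] ℕ.* ([ w ≟ 0# ] ℕ.* q))
      ≡⟨ cong₂ ℕ._+_ (trans (∑-const e 1) (ℕ.*-identityʳ q)) (∑-δ e 0# (λ _ → [ w ≟ 0# ] ℕ.* q)) ⟩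
    q ℕ.+ [ w ≟ 0# ] ℕ.* q ∎
    where
    open ≡-Reasoning
    row : ∀ x → ∑ e (λ y → [ x * y ≟ w ]) ℕ.+ [ x ≟ 0# ] ≡ 1 ℕ.+ [ x ≟ 0# ] ℕ.* ([ w ≟ 0# ] ℕ.* q)
    row x with x ≟ 0#
    ... | no x≢0 = cong (ℕ._+ 0) (trans (∑-cong e (λ y → cong (λ v → [ v ≟ w ]) (*-comm x y))) (#x*c≡w x≢0 w))
    ... | yes refl = trans (ℕ.+-comm _ 1) (cong suc (begin
      ∑ e (λ y → [ 0# * y ≟ w ])   ≡⟨ ∑-cong e (λ y → []-cong (0# * y ≟ w) (w ≟ 0#) (λ eq → trans (sym eq) (zeroˡ y)) (λ eq → trans (zeroˡ y) (sym eq))) ⟩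
      ∑ e (λ _ → [ w ≟ 0# ])       ≡⟨ ∑-const e [ w ≟ 0# ] ⟩
      q ℕ.* [ w ≟ 0# ]             ≡⟨ ℕ.*-comm q _ ⟩
      [ w ≟ 0# ] ℕ.* q             ≡⟨ ℕ.+-identityʳ _ ⟨
      [ w ≟ 0# ] ℕ.* q ℕ.+ 0       ∎))

  -1≢0 : - 1# ≢ 0#
  -1≢0 eq = 1≢0 (trans (sym (+-identityˡ 1#)) (trans (cong (_+ 1#) (sym eq)) (-‿inverseˡ 1#)))

  -- t ↦ t² + t takes the value 0 at both 0 and -1, so it is not onto.
  rootless : ∃[ d ] (∀ t → t * t + t + d ≢ 0#)
  rootless with ∃? e (λ d → ∀? (λ t → ¬? (t * t + t + d ≟ 0#)))
    where
    ∀? : ∀ {P : K → Set} → (∀ t → Dec (P t)) → Dec (∀ t → P t)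
    ∀? {P} P? with ∃? e (λ t → ¬? (P? t))
    ... | yes (t , ¬Pt) = no (λ ∀P → ¬Pt (∀P t))
    ... | no ¬∃ = yes (λ t → decidable-stable (P? t) (λ ¬Pt → ¬∃ (t , ¬Pt)))
  ... | yes found = found
  ... | no ¬found = contradiction (trans (sym s0≡-1) s0≡0) -1≢0
    where
    root : ∀ d → ∃[ t ] t * t + t + d ≡ 0#
    root d with ∃? e (λ t → t * t + t + d ≟ 0#)
    ... | yes t = t
    ... | no ¬t = contradiction (d , λ t eq → ¬t (t , eq)) ¬found
    -- If every `d` had a root, choosing one would be injective, because the root determines `d`,
    -- and therefore onto. A `t` with t² + t = 0 can only be chosen for `d = 0`, so 0 and -1 would
    -- both be `s 0#`.
    s : K → K
    s d = proj₁ (root d)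
    s-injective : ∀ d d′ → s d ≡ s d′ → d ≡ d′
    s-injective d d′ eq = ∙-cancelˡ (s d′ * s d′ + s d′) d d′
      (trans (cong (λ t → t * t + t + d) (sym eq)) (trans (proj₂ (root d)) (sym (proj₂ (root d′)))))
    onto : ∀ t → t * t + t ≡ 0# → s 0# ≡ t
    onto t φt≡0 = trans (cong s (sym d≡0)) sd≡t
      where
      d = proj₁ (injective⇒surjective e s s-injective t)
      sd≡t = proj₂ (injective⇒surjective e s s-injective t)
      d≡0 : d ≡ 0#
      d≡0 = begin
        d                     ≡⟨ +-identityˡ d ⟨
        0# + d                ≡⟨ cong (_+ d) φt≡0 ⟨
        t * t + t + d         ≡⟨ cong (λ t → t * t + t + d) sd≡t ⟨
        s d * s d + s d + d   ≡⟨ proj₂ (root d) ⟩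
        0#                    ∎
        where open ≡-Reasoning
    s0≡0 : s 0# ≡ 0#
    s0≡0 = onto 0# (trans (+-identityʳ _) (zeroˡ 0#))
    s0≡-1 : s 0# ≡ - 1#
    s0≡-1 = onto (- 1#) (trans (cong (_+ (- 1#)) (trans (sym (-‿distribˡ-* 1# (- 1#))) (trans (cong -_ (*-identityˡ _)) refl))) (-‿inverseˡ (- 1#)))

  δ₀-idem : ∀ w → [ w ≟ 0# ] ℕ.* [ w ≟ 0# ] ≡ [ w ≟ 0# ]
  δ₀-idem w with w ≟ 0#
  ... | yes _ = refl
  ... | no _ = refl

  module Norm (d : K) (irreducible : ∀ t → t * t + t + d ≢ 0#) where

    -- The homogenised t² + t + d, that is, the norm form of the quadratic extension of `K` that
    -- this polynomial defines.
    norm : K² → K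
    norm (x , y) = x * x + x * y + d * (y * y)

    norm-0 : norm 0² ≡ 0#
    norm-0 = trans (cong₂ _+_ (trans (cong₂ _+_ (zeroˡ 0#) (zeroˡ 0#)) (+-identityˡ 0#)) (trans (cong (d *_) (zeroˡ 0#)) (zeroʳ d))) (+-identityˡ 0#)

    x*x≡0⇒x≡0 : ∀ x → x * x ≡ 0# → x ≡ 0#
    x*x≡0⇒x≡0 x eq = [ (λ z → z) , (λ z → z) ]′ (domain x x eq)

    norm-anisotropic : ∀ z → norm z ≡ 0# → z ≡ 0²
    norm-anisotropic (x , y) eq with y ≟ 0#
    ... | yes refl = cong (_, 0#) (x*x≡0⇒x≡0 x (begin
      x * x                              ≡⟨ trans (+-identityʳ _) (+-identityʳ _) ⟨
      x * x + 0# + 0#                    ≡⟨ cong₂ (λ a b → x * x + a + b) (zeroʳ x) (trans (cong (d *_) (zeroˡ 0#)) (zeroʳ d)) ⟨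
      x * x + x * 0# + d * (0# * 0#)     ≡⟨ eq ⟩
      0#                                 ∎))
      where open ≡-Reasoning
    ... | no y≢0 with t , refl ← divide y≢0 x = [ (λ z → contradiction z (irreducible t)) , (λ z → contradiction (x*x≡0⇒x≡0 y z) y≢0) ]′
      (domain (t * t + t + d) (y * y) (trans (sym (norm-homogeneous d t y)) eq))

    polar : K² → K²
    polar (a , b) = a + a + b , a + (d * b + d * b)

    -- 2 norm (a , b) is a linear combination of the coordinates of polar (a , b); in characteristic 2,
    -- polar (a , b) is (b , a).
    polar-injective : ∀ a → polar a ≡ 0² → a ≡ 0²
    polar-injective (a , b) eq with 1# + 1# ≟ 0#
    ... | yes 2≡0 = cong₂ _,_ (trans (sym (trans (cong (a +_) (double (d * b))) (+-identityʳ a))) (cong proj₂ eq))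
                              (trans (sym (trans (cong (_+ b) (double a)) (+-identityˡ b))) (cong proj₁ eq))
      where
      double : ∀ x → x + x ≡ 0#
      double x = trans (sym (cong₂ _+_ (*-identityˡ x) (*-identityˡ x))) (trans (sym (distribʳ x 1# 1#)) (trans (cong (_* x) 2≡0) (zeroˡ x)))
    ... | no 2≢0 = norm-anisotropic (a , b) ([ (λ z → contradiction z 2≢0) , (λ z → z) ]′ (domain (1# + 1#) N (begin
      (1# + 1#) * N                                    ≡⟨ distribʳ N 1# 1# ⟩
      1# * N + 1# * N                                  ≡⟨ cong₂ _+_ (*-identityˡ N) (*-identityˡ N) ⟩
      N + N                                            ≡⟨ norm-double d a b ⟩
      a * (a + a + b) + b * (a + (d * b + d * b))      ≡⟨ cong₂ (λ u v → a * u + b * v) (cong proj₁ eq) (cong proj₂ eq) ⟩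
      a * 0# + b * 0#                                  ≡⟨ cong₂ _+_ (zeroʳ a) (zeroʳ b) ⟩
      0# + 0#                                          ≡⟨ +-identityˡ 0# ⟩
      0#                                               ∎)))
      where
      open ≡-Reasoning
      N = norm (a , b)

    norm-perfect : PerfectNonlinear norm
    norm-perfect = polar⇒perfect norm polar polar-injective (λ (x , y) (a , b) → norm-+ d x y a b)

  -- First and second moments of the fibre sizes.

  _≟²_ : (z z′ : K²) → Dec (z ≡ z′)
  _≟²_ = ↔⇒≟ e²

  +²-↔ : K² → K² ↔ K²
  +²-↔ (x , y) = mk↔ₛ′ ((x , y) +²_) (λ (a , b) → - x + a , - y + b)
    (λ (a , b) → cong₂ _,_ (cancel x a) (cancel y b)) (λ (a , b) → cong₂ _,_ (cancel′ x a) (cancel′ y b))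
    where
    cancel : ∀ x a → x + (- x + a) ≡ a
    cancel x a = trans (sym (+-assoc x (- x) a)) (trans (cong (_+ a) (-‿inverseʳ x)) (+-identityˡ a))
    cancel′ : ∀ x a → - x + (x + a) ≡ a
    cancel′ x a = trans (sym (+-assoc (- x) x a)) (trans (cong (_+ a) (-‿inverseˡ x)) (+-identityˡ a))

  +²-identityʳ : ∀ z → z +² 0² ≡ z
  +²-identityʳ (x , y) = cong₂ _,_ (+-identityʳ x) (+-identityʳ y)

  ∑# : ∀ f → ∑ e (λ w → # f ⁻¹ w) ≡ q ℕ.* q
  ∑# f = begin
    ∑ e (λ w → # f ⁻¹ w)                       ≡⟨ ∑-swap e e² (λ w z → [ f z ≟ w ]) ⟩
    ∑ e² (λ z → ∑ e (λ w → [ f z ≟ w ]))       ≡⟨ ∑-cong e² (λ z → ∑-unique e (λ w → f z ≟ w) (f z) refl (λ w eq → sym eq)) ⟩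
    ∑ e² (λ _ → 1)                             ≡⟨ trans (∑-const e² 1) (ℕ.*-identityʳ _) ⟩
    q ℕ.* q                                    ∎
    where open ≡-Reasoning

  -- The sum of squares counts pairs `z`, `z +² a` with equal values, that is, zeros of the
  -- derivatives: q² of them for `a = 0` and `q` for each other `a`. The added `q` completes q² - 1
  -- directions to q².
  ∑#² : ∀ f → PerfectNonlinear f →
        ∑ e (λ w → # f ⁻¹ w ℕ.* # f ⁻¹ w) ℕ.+ q ≡ (q ℕ.* q) ℕ.* q ℕ.+ q ℕ.* q
  ∑#² f perfect = begin
    ∑ e (λ w → n w ℕ.* n w) ℕ.+ q
      ≡⟨ cong (ℕ._+ q) squares ⟩
    ∑ e² (λ a → D a) ℕ.+ q
      ≡⟨ cong (∑ e² D ℕ.+_) (∑-δ e² 0² (λ _ → q)) ⟨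
    ∑ e² D ℕ.+ ∑ e² (λ a → [ a ≟² 0² ] ℕ.* q)
      ≡⟨ ∑-+ e² D (λ a → [ a ≟² 0² ] ℕ.* q) ⟨
    ∑ e² (λ a → D a ℕ.+ [ a ≟² 0² ] ℕ.* q)
      ≡⟨ ∑-cong e² D-value ⟩
    ∑ e² (λ a → q ℕ.+ [ a ≟² 0² ] ℕ.* (q ℕ.* q))
      ≡⟨ ∑-+ e² (λ _ → q) (λ a → [ a ≟² 0² ] ℕ.* (q ℕ.* q)) ⟩
    ∑ e² (λ _ → q) ℕ.+ ∑ e² (λ a → [ a ≟² 0² ] ℕ.* (q ℕ.* q))
      ≡⟨ cong₂ ℕ._+_ (∑-const e² q) (∑-δ e² 0² (λ _ → q ℕ.* q)) ⟩
    (q ℕ.* q) ℕ.* q ℕ.+ q ℕ.* q ∎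
    where
    open ≡-Reasoning
    n : K → ℕ
    n w = # f ⁻¹ w
    D : K² → ℕ
    D a = # (λ z → f (z +² a) - f z) ⁻¹ 0#
    squares : ∑ e (λ w → n w ℕ.* n w) ≡ ∑ e² D
    squares = begin
      ∑ e (λ w → n w ℕ.* n w)
        ≡⟨ ∑-cong e (λ w → ∑-*ʳ e² (n w) (λ z → [ f z ≟ w ])) ⟨
      ∑ e (λ w → ∑ e² (λ z → [ f z ≟ w ] ℕ.* n w))
        ≡⟨ ∑-swap e e² (λ w z → [ f z ≟ w ] ℕ.* n w) ⟩
      ∑ e² (λ z → ∑ e (λ w → [ f z ≟ w ] ℕ.* n w))
        ≡⟨ ∑-cong e² (λ z → ∑-δ′ e (f z) n) ⟩
      ∑ e² (λ z → n (f z))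
        ≡⟨ ∑-cong e² (λ z → ∑-reindex e² e² (+²-↔ z) (λ z′ → [ f z′ ≟ f z ])) ⟩
      ∑ e² (λ z → ∑ e² (λ a → [ f (z +² a) ≟ f z ]))
        ≡⟨ ∑-swap e² e² (λ z a → [ f (z +² a) ≟ f z ]) ⟩
      ∑ e² (λ a → ∑ e² (λ z → [ f (z +² a) ≟ f z ]))
        ≡⟨ ∑-cong e² (λ a → ∑-cong e² (λ z → []-cong (f (z +² a) ≟ f z) (f (z +² a) - f z ≟ 0#)
             (λ eq → trans (cong (_- f z) eq) (-‿inverseʳ (f z))) (x∙y⁻¹≈ε⇒x≈y (f (z +² a)) (f z)))) ⟩
      ∑ e² D ∎
    D-value : ∀ a → D a ℕ.+ [ a ≟² 0² ] ℕ.* q ≡ q ℕ.+ [ a ≟² 0² ] ℕ.* (q ℕ.* q)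
    D-value a with a ≟² 0²
    ... | no a≢0 = cong (ℕ._+ 0) (perfect a a≢0 0#)
    ... | yes refl = trans (ℕ.+-comm (D 0²) _) (cong₂ ℕ._+_ (ℕ.+-identityʳ q) (trans
      (trans (∑-cong e² (λ z → []-yes (f (z +² 0²) - f z ≟ 0#) (trans (cong (λ z′ → f z′ - f z) (+²-identityʳ z)) (-‿inverseʳ (f z)))))
        (trans (∑-const e² 1) (ℕ.*-identityʳ _)))
      (sym (ℕ.+-identityʳ _))))

  -- The fibre sizes, corrected by q at 0, have mean q + 1 and vanishing variance.
  anisotropic-fibres : ∀ f → PerfectNonlinear f → # f ⁻¹ 0# ≡ 1 → ∀ w → # f ⁻¹ w ℕ.+ [ w ≟ 0# ] ℕ.* q ≡ suc q
  anisotropic-fibres f perfect n0≡1 w = amgm-tight (m w) c (∑-≤-tight e (λ w → c ℕ.* m w ℕ.+ c ℕ.* m w) (λ w → m w ℕ.* m w ℕ.+ c ℕ.* c)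
    (λ w → amgm (m w) c) sums w)
    where
    open ≡-Reasoning
    c = suc q
    n m : K → ℕ
    n w = # f ⁻¹ w
    m w = n w ℕ.+ [ w ≟ 0# ] ℕ.* q

    square-shift : ∀ m t → m ℕ.* m ℕ.+ (m ℕ.+ t) ℕ.* (m ℕ.+ t) ≡ ((m ℕ.+ t) ℕ.* m ℕ.+ (m ℕ.+ t) ℕ.* m) ℕ.+ t ℕ.* t
    square-shift = ℕ-Solver.solve-∀

    square-shift′ : ∀ c t → (c ℕ.+ t) ℕ.* (c ℕ.+ t) ℕ.+ c ℕ.* c ≡ (c ℕ.* (c ℕ.+ t) ℕ.+ c ℕ.* (c ℕ.+ t)) ℕ.+ t ℕ.* t
    square-shift′ = ℕ-Solver.solve-∀

    -- Here `t` is the distance between `m` and `c`: the expansion of the squared difference,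
    -- written without subtraction.
    difference : ∀ m c → ∃[ t ] (m ℕ.* m ℕ.+ c ℕ.* c ≡ (c ℕ.* m ℕ.+ c ℕ.* m) ℕ.+ t ℕ.* t) × (t ≡ 0 → m ≡ c)
    difference m c with ℕ.≤-total m c
    ... | inj₁ m≤c with t , refl ← ℕ.m≤n⇒∃[o]m+o≡n m≤c = t , square-shift m t , λ { refl → sym (ℕ.+-identityʳ m) }
    ... | inj₂ c≤m with t , refl ← ℕ.m≤n⇒∃[o]m+o≡n c≤m = t , square-shift′ c t , λ { refl → ℕ.+-identityʳ c }

    amgm : ∀ m c → c ℕ.* m ℕ.+ c ℕ.* m ℕ.≤ m ℕ.* m ℕ.+ c ℕ.* c
    amgm m c with t , eq , _ ← difference m c = subst (c ℕ.* m ℕ.+ c ℕ.* m ℕ.≤_) (sym eq) (ℕ.m≤m+n _ (t ℕ.* t))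

    amgm-tight : ∀ m c → c ℕ.* m ℕ.+ c ℕ.* m ≡ m ℕ.* m ℕ.+ c ℕ.* c → m ≡ c
    amgm-tight m c tight with t , eq , t≡0⇒ ← difference m c = t≡0⇒ (t≡0 t (ℕ.+-cancelˡ-≡ (c ℕ.* m ℕ.+ c ℕ.* m) (t ℕ.* t) 0
      (trans (sym eq) (trans (sym tight) (sym (ℕ.+-identityʳ _))))))
      where
      t≡0 : ∀ t → t ℕ.* t ≡ 0 → t ≡ 0
      t≡0 zero _ = refl

    ∑m : ∑ e m ≡ q ℕ.* q ℕ.+ q
    ∑m = trans (∑-+ e n (λ w → [ w ≟ 0# ] ℕ.* q)) (cong₂ ℕ._+_ (∑# f) (∑-δ e 0# (λ _ → q)))

    expand : ∀ n δ q → δ ℕ.* δ ≡ δ → (n ℕ.+ δ ℕ.* q) ℕ.* (n ℕ.+ δ ℕ.* q) ≡ n ℕ.* n ℕ.+ δ ℕ.* ((n ℕ.+ n) ℕ.* q ℕ.+ q ℕ.* q)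
    expand n δ q δδ≡δ = trans (poly n δ q) (trans
      (cong (λ ε → n ℕ.* n ℕ.+ (δ ℕ.* ((n ℕ.+ n) ℕ.* q) ℕ.+ ε ℕ.* (q ℕ.* q))) δδ≡δ)
      (cong (n ℕ.* n ℕ.+_) (sym (ℕ.*-distribˡ-+ δ ((n ℕ.+ n) ℕ.* q) (q ℕ.* q)))))
      where
      poly : ∀ n δ q → (n ℕ.+ δ ℕ.* q) ℕ.* (n ℕ.+ δ ℕ.* q) ≡ n ℕ.* n ℕ.+ (δ ℕ.* ((n ℕ.+ n) ℕ.* q) ℕ.+ (δ ℕ.* δ) ℕ.* (q ℕ.* q))
      poly = ℕ-Solver.solve-∀

    ∑m² : ∑ e (λ w → m w ℕ.* m w) ≡ ∑ e (λ w → n w ℕ.* n w) ℕ.+ (2 ℕ.* q ℕ.+ q ℕ.* q)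
    ∑m² = begin
      ∑ e (λ w → m w ℕ.* m w)
        ≡⟨ ∑-cong e (λ w → expand (n w) [ w ≟ 0# ] q (δ₀-idem w)) ⟩
      ∑ e (λ w → n w ℕ.* n w ℕ.+ [ w ≟ 0# ] ℕ.* ((n w ℕ.+ n w) ℕ.* q ℕ.+ q ℕ.* q))
        ≡⟨ ∑-+ e (λ w → n w ℕ.* n w) (λ w → [ w ≟ 0# ] ℕ.* ((n w ℕ.+ n w) ℕ.* q ℕ.+ q ℕ.* q)) ⟩
      ∑ e (λ w → n w ℕ.* n w) ℕ.+ ∑ e (λ w → [ w ≟ 0# ] ℕ.* ((n w ℕ.+ n w) ℕ.* q ℕ.+ q ℕ.* q))
        ≡⟨ cong (∑ e (λ w → n w ℕ.* n w) ℕ.+_) (∑-δ e 0# (λ w → (n w ℕ.+ n w) ℕ.* q ℕ.+ q ℕ.* q)) ⟩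
      ∑ e (λ w → n w ℕ.* n w) ℕ.+ ((n 0# ℕ.+ n 0#) ℕ.* q ℕ.+ q ℕ.* q)
        ≡⟨ cong (λ a → ∑ e (λ w → n w ℕ.* n w) ℕ.+ ((a ℕ.+ a) ℕ.* q ℕ.+ q ℕ.* q)) n0≡1 ⟩
      ∑ e (λ w → n w ℕ.* n w) ℕ.+ (2 ℕ.* q ℕ.+ q ℕ.* q) ∎

    ∑m²≡ : ∑ e (λ w → m w ℕ.* m w) ≡ q ℕ.* (c ℕ.* c)
    ∑m²≡ = ℕ.+-cancelʳ-≡ q _ _ (begin
      ∑ e (λ w → m w ℕ.* m w) ℕ.+ q                                  ≡⟨ cong (ℕ._+ q) ∑m² ⟩
      ∑ e (λ w → n w ℕ.* n w) ℕ.+ (2 ℕ.* q ℕ.+ q ℕ.* q) ℕ.+ q        ≡⟨ swap (∑ e (λ w → n w ℕ.* n w)) (2 ℕ.* q ℕ.+ q ℕ.* q) q ⟩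
      ∑ e (λ w → n w ℕ.* n w) ℕ.+ q ℕ.+ (2 ℕ.* q ℕ.+ q ℕ.* q)        ≡⟨ cong (ℕ._+ (2 ℕ.* q ℕ.+ q ℕ.* q)) (∑#² f perfect) ⟩
      (q ℕ.* q) ℕ.* q ℕ.+ q ℕ.* q ℕ.+ (2 ℕ.* q ℕ.+ q ℕ.* q)          ≡⟨ collect q ⟩
      q ℕ.* (c ℕ.* c) ℕ.+ q                                          ∎)
      where
      swap : ∀ a b c → a ℕ.+ b ℕ.+ c ≡ a ℕ.+ c ℕ.+ b
      swap = ℕ-Solver.solve-∀
      collect : ∀ q → (q ℕ.* q) ℕ.* q ℕ.+ q ℕ.* q ℕ.+ (2 ℕ.* q ℕ.+ q ℕ.* q) ≡ q ℕ.* ((1 ℕ.+ q) ℕ.* (1 ℕ.+ q)) ℕ.+ q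
      collect = ℕ-Solver.solve-∀

    -- Both totals are 2q(q+1)². This equality in the summed inequality 2cm ≤ m² + c² says that the
    -- variance of `m` around its mean `c` is zero.
    sums : ∑ e (λ w → c ℕ.* m w ℕ.+ c ℕ.* m w) ≡ ∑ e (λ w → m w ℕ.* m w ℕ.+ c ℕ.* c)
    sums = begin
      ∑ e (λ w → c ℕ.* m w ℕ.+ c ℕ.* m w)                 ≡⟨ ∑-+ e (λ w → c ℕ.* m w) (λ w → c ℕ.* m w) ⟩
      ∑ e (λ w → c ℕ.* m w) ℕ.+ ∑ e (λ w → c ℕ.* m w)     ≡⟨ cong (λ s → s ℕ.+ s) (trans (∑-*ˡ e c m) (cong (c ℕ.*_) ∑m)) ⟩
      c ℕ.* (q ℕ.* q ℕ.+ q) ℕ.+ c ℕ.* (q ℕ.* q ℕ.+ q)     ≡⟨ collect q ⟩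
      q ℕ.* (c ℕ.* c) ℕ.+ q ℕ.* (c ℕ.* c)                 ≡⟨ cong₂ ℕ._+_ (sym ∑m²≡) (sym (∑-const e (c ℕ.* c))) ⟩
      ∑ e (λ w → m w ℕ.* m w) ℕ.+ ∑ e (λ _ → c ℕ.* c)     ≡⟨ ∑-+ e (λ w → m w ℕ.* m w) (λ _ → c ℕ.* c) ⟨
      ∑ e (λ w → m w ℕ.* m w ℕ.+ c ℕ.* c)                 ∎
      where
      collect : ∀ q → (1 ℕ.+ q) ℕ.* (q ℕ.* q ℕ.+ q) ℕ.+ (1 ℕ.+ q) ℕ.* (q ℕ.* q ℕ.+ q) ≡
                q ℕ.* ((1 ℕ.+ q) ℕ.* (1 ℕ.+ q)) ℕ.+ q ℕ.* ((1 ℕ.+ q) ℕ.* (1 ℕ.+ q))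
      collect = ℕ-Solver.solve-∀

  anisotropic-exists : ∃[ f ] PerfectNonlinear f × (∀ w → # f ⁻¹ w ℕ.+ [ w ≟ 0# ] ℕ.* q ≡ suc q)
  anisotropic-exists with d , irreducible ← rootless = norm , norm-perfect , anisotropic-fibres norm norm-perfect
    (∑-unique e² (λ z → norm z ≟ 0#) 0² norm-0 norm-anisotropic)
    where open Norm d irreducible

  ∑-fibres : ∀ (g : K² → K) (h : K → ℕ) → ∑ e² (λ z → h (g z)) ≡ ∑ e (λ w → # g ⁻¹ w ℕ.* h w)
  ∑-fibres g h = begin
    ∑ e² (λ z → h (g z))                                ≡⟨ ∑-cong e² (λ z → ∑-δ′ e (g z) h) ⟨
    ∑ e² (λ z → ∑ e (λ w → [ g z ≟ w ] ℕ.* h w))        ≡⟨ ∑-swap e e² (λ w z → [ g z ≟ w ] ℕ.* h w) ⟨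
    ∑ e (λ w → ∑ e² (λ z → [ g z ≟ w ] ℕ.* h w))        ≡⟨ ∑-cong e (λ w → ∑-*ʳ e² (h w) (λ z → [ g z ≟ w ])) ⟩
    ∑ e (λ w → # g ⁻¹ w ℕ.* h w)                        ∎
    where open ≡-Reasoning

-- Projecting maps on K² to bent functions.

module BentFunctions (p : ℕ) .{{_ : NonZero p}} (pr : Prime p) where

  open Residues p
  open CommutativeRing commutativeRing using (semiring; 1#)
  open import Algebra.Properties.Semiring.Mult semiring using () renaming (_×_ to _·_)

  ·1-ι : ∀ n → ι n ≡ n · 1#
  ·1-ι zero    = refl
  ·1-ι (suc n) = trans (ι-homo-+ 1 n) (cong (1# +ₚ_) (·1-ι n))

  open FieldConstruction isCommutativeRing Fin._≟_ (FiniteDomain.divide isCommutativeRing (domain pr) (↔-id F)) (1≢0 pr)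
  open PrimeField pr (↔-id F) (trans (sym (·1-ι p)) ι-p) (λ c → toℕ c , trans (sym (ι-toℕ c)) (·1-ι (toℕ c))) public

  split : ∀ {A : Set} m {n} → Vec A (m ℕ.+ n) ↔ (Vec A m × Vec A n)
  split m = mk↔ₛ′ (λ x → take m x , drop m x) (λ (u , v) → u ++ v)
    (λ (u , v) → cong₂ _,_ (proj₁ (parts u v)) (proj₂ (parts u v))) (take++drop≡id m)
    where
    parts : ∀ u v → take m (u ++ v) ≡ u × drop m (u ++ v) ≡ v
    parts u v = ++-injective (take m (u ++ v)) u (take++drop≡id m (u ++ v))

  ⊖≡⊕- : ∀ {n} (u v : 𝔽^ p n) → u ⊖ v ≡ u ⊕ Vec.map negₚ v
  ⊖≡⊕- []      []      = refl
  ⊖≡⊕- (x ∷ u) (y ∷ v) = cong₂ _∷_ (-ₚ≡+- x y) (⊖≡⊕- u v)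

  take-⊖ : ∀ m {n} (u v : 𝔽^ p (m ℕ.+ n)) → take m u ⊖ take m v ≡ take m (u ⊕ Vec.map negₚ v)
  take-⊖ m u v = sym (trans (cong (take m) (sym (⊖≡⊕- u v))) (take-zipWith _-ₚ_ u v))

  module _ (m l : ℕ) (𝕂 : FieldStructure (m ℕ.+ l)) where

    open import Data.Nat.Base using (_^_)

    private
      k q P : ℕ
      k = m ℕ.+ l
      q = p ^ k
      P = p ^ l
      K = 𝔽^ p k

      e : ∀ n → 𝔽^ p n ↔ Fin (p ^ n)
      e = Vec↔Fin (↔-id F)

      infix 4 _≟ᵛ_
      _≟ᵛ_ : ∀ {n} (u v : 𝔽^ p n) → Dec (u ≡ v)
      _≟ᵛ_ = ↔⇒≟ (e _)

    open FieldStructure 𝕂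
    open PerfectNonlinearity ⊗-isCommutativeRing ⊗-domain 1ⱽ≢0ⱽ (e k)

    project : (K² → K) → 𝔽^ p (k ℕ.+ k) → 𝔽^ p m
    project f x = take m (f (Inverse.to (split k) x))

    h : 𝔽^ p m → K → ℕ
    h β w = [ take m w ≟ᵛ β ]

    ∑h : ∀ β → ∑ (e k) (h β) ≡ P
    ∑h β = begin
      ∑ (e k) (λ w → [ take m w ≟ᵛ β ])                         ≡⟨ ∑-reindex (e k) (e m ×ᵉ e l) (split m) (λ (u , _) → [ u ≟ᵛ β ]) ⟨
      ∑ (e m ×ᵉ e l) (λ (u , _) → [ u ≟ᵛ β ])                   ≡⟨ ∑-× (e m) (e l) (λ (u , _) → [ u ≟ᵛ β ]) ⟩
      ∑ (e m) (λ u → ∑ (e l) (λ _ → [ u ≟ᵛ β ]))                ≡⟨ ∑-cong (e m) (λ u → trans (∑-const (e l) _) (ℕ.*-comm P _)) ⟩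
      ∑ (e m) (λ u → [ u ≟ᵛ β ] ℕ.* P)                          ≡⟨ ∑-δ (e m) β (λ _ → P) ⟩
      P                                                         ∎
      where open ≡-Reasoning

    -- `F` has to agree with the projection of `g` only pointwise, so the same count serves
    -- `project f` and its derivatives.
    fibre-cardinality : (F : 𝔽^ p (k ℕ.+ k) → 𝔽^ p m) (g : K² → K) → (∀ x → F x ≡ take m (g (Inverse.to (split k) x))) →
      ∀ β {N} → ∑ (e k) (λ w → # g ⁻¹ w ℕ.* h β w) ≡ N → HasCardinality (Fibre F β) N
    fibre-cardinality F g F≡ β refl = subst (λ N → Fibre F β ↔ Fin N) count
      (subset↔ e₂ (λ x → F x ≟ᵛ β) (λ _ → Decidable⇒UIP.≡-irrelevant (≡-dec Fin._≟_)))
      where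
      open ≡-Reasoning
      e₂ = ↔-trans (split k) e²
      count : ∑ e₂ (λ x → [ F x ≟ᵛ β ]) ≡ ∑ (e k) (λ w → # g ⁻¹ w ℕ.* h β w)
      count = begin
        ∑ e₂ (λ x → [ F x ≟ᵛ β ])                        ≡⟨ ∑-cong e₂ (λ x → cong (λ y → [ y ≟ᵛ β ]) (F≡ x)) ⟩
        ∑ e₂ (λ x → h β (g (Inverse.to (split k) x)))    ≡⟨ ∑-reindex e₂ e² (split k) (λ z → h β (g z)) ⟨
        ∑ e² (λ z → h β (g z))                           ≡⟨ ∑-fibres g (h β) ⟩
        ∑ (e k) (λ w → # g ⁻¹ w ℕ.* h β w)               ∎

    p^[2k∸m] : p ^ (k ℕ.+ k ∸ m) ≡ q ℕ.* P
    p^[2k∸m] = trans (cong (p ^_) (trans (cong (_∸ m) (ℕ.+-assoc m l k)) (trans (ℕ.m+n∸m≡n m (l ℕ.+ k)) (ℕ.+-comm l k))))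
      (ℕ.^-distribˡ-+-* p k l)

    [k+k]/2 : (k ℕ.+ k) / 2 ≡ k
    [k+k]/2 = trans (cong (_/ 2) (trans (cong (k ℕ.+_) (sym (ℕ.+-identityʳ k))) (ℕ.*-comm 2 k))) (m*n/n≡m k 2)

    p^[k+k]/2 : p ^ ((k ℕ.+ k) / 2) ≡ q
    p^[k+k]/2 = cong (p ^_) [k+k]/2

    p^[[k+k]/2∸m] : p ^ ((k ℕ.+ k) / 2 ∸ m) ≡ P
    p^[[k+k]/2∸m] = cong (p ^_) (trans (cong (_∸ m) [k+k]/2) (ℕ.m+n∸m≡n m l))

    -- The projection is additive and so commutes with taking derivatives. Each of the `P` elements
    -- of `K` over `b` contributes `q` solutions.
    project-bent : ∀ f → PerfectNonlinear f → Bent (project f)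
    project-bent f perfect a a≢0 b = fibre-cardinality _ (λ z → f (z +² a′) ⊕ Vec.map negₚ (f z)) derivative b (begin
      ∑ (e k) (λ w → # (λ z → f (z +² a′) ⊕ Vec.map negₚ (f z)) ⁻¹ w ℕ.* h b w)   ≡⟨ ∑-cong (e k) (λ w → cong (ℕ._* h b w) (perfect a′ a′≢0 w)) ⟩
      ∑ (e k) (λ w → q ℕ.* h b w)                                                 ≡⟨ ∑-*ˡ (e k) q (h b) ⟩
      q ℕ.* ∑ (e k) (h b)                                                         ≡⟨ cong (q ℕ.*_) (∑h b) ⟩
      q ℕ.* P                                                                     ≡⟨ p^[2k∸m] ⟨
      p ^ (k ℕ.+ k ∸ m)                                                           ∎)
      where
      open ≡-Reasoning
      σ : 𝔽^ p (k ℕ.+ k) → K²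
      σ = Inverse.to (split k)
      a′ = σ a
      σ-⊕ : ∀ x y → σ (x ⊕ y) ≡ σ x +² σ y
      σ-⊕ x y = cong₂ _,_ (take-zipWith _+ₚ_ x y) (drop-zipWith {m = k} _+ₚ_ x y)
      σ-0 : ∀ j n → take j (0ᵥ {p} {j ℕ.+ n}) ≡ 0ᵥ × drop j (0ᵥ {p} {j ℕ.+ n}) ≡ 0ᵥ
      σ-0 zero    n = refl , refl
      σ-0 (suc j) n = cong (_ ∷_) (proj₁ (σ-0 j n)) , proj₂ (σ-0 j n)
      a′≢0 : a′ ≢ 0²
      a′≢0 eq = a≢0 (to-injective′ (trans eq (sym (cong₂ _,_ (proj₁ (σ-0 k k)) (proj₂ (σ-0 k k))))))
        where
        to-injective′ : ∀ {x y} → σ x ≡ σ y → x ≡ y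
        to-injective′ {x} {y} eq = trans (sym (take++drop≡id k x)) (trans (cong (λ (u , v) → u ++ v) eq) (take++drop≡id k y))
      derivative : ∀ x → project f (x ⊕ a) ⊖ project f x ≡ take m (f (σ x +² a′) ⊕ Vec.map negₚ (f (σ x)))
      derivative x = trans (take-⊖ m (f (σ (x ⊕ a))) (f (σ x))) (cong (λ z → take m (f z ⊕ Vec.map negₚ (f (σ x)))) (σ-⊕ x a))

    h-α : h (take m 0ᵥ) 0ᵥ ≡ 1
    h-α = []-yes (take m 0ᵥ ≟ᵛ take m 0ᵥ) refl

    h-β : ∀ β → β ≢ take m 0ᵥ → h β 0ᵥ ≡ 0
    h-β β β≢α = []-no (take m 0ᵥ ≟ᵛ β) (β≢α ∘ sym)

    -- Each of the `P` elements of `K` over `β` has `q - 1` preimages, except that zero has `q`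
    -- more; so the image of zero is the exceptional value. Adding `P` to the count absorbs the
    -- subtracted ones.
    project-almostBalanced⁺ : ∀ f → (∀ w → # f ⁻¹ w ℕ.+ 1 ≡ q ℕ.+ [ w ≟ᵛ 0ᵥ ] ℕ.* q) → AlmostBalanced⁺ (project f)
    project-almostBalanced⁺ f #f = take m 0ᵥ ,
      fibre-cardinality (project f) f (λ _ → refl) (take m 0ᵥ) (begin
        T (take m 0ᵥ)                                ≡⟨ ℕ.m+n∸n≡m _ P ⟨
        T (take m 0ᵥ) ℕ.+ P ∸ P                      ≡⟨ cong (_∸ P) (T+P (take m 0ᵥ)) ⟩
        q ℕ.* P ℕ.+ q ℕ.* h (take m 0ᵥ) 0ᵥ ∸ P       ≡⟨ cong (λ a → q ℕ.* P ℕ.+ a ∸ P) (trans (cong (q ℕ.*_) h-α) (ℕ.*-identityʳ q)) ⟩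
        q ℕ.* P ℕ.+ q ∸ P                            ≡⟨ cong₂ _∸_ (cong₂ ℕ._+_ p^[2k∸m] p^[k+k]/2) p^[[k+k]/2∸m] ⟨
        p ^ (k ℕ.+ k ∸ m) ℕ.+ p ^ ((k ℕ.+ k) / 2) ∸ p ^ ((k ℕ.+ k) / 2 ∸ m) ∎) ,
      λ β β≢α → fibre-cardinality (project f) f (λ _ → refl) β (begin
        T β                                          ≡⟨ ℕ.m+n∸n≡m _ P ⟨
        T β ℕ.+ P ∸ P                                ≡⟨ cong (_∸ P) (T+P β) ⟩
        q ℕ.* P ℕ.+ q ℕ.* h β 0ᵥ ∸ P                 ≡⟨ cong (λ a → q ℕ.* P ℕ.+ a ∸ P) (trans (cong (q ℕ.*_) (h-β β β≢α)) (ℕ.*-zeroʳ q)) ⟩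
        q ℕ.* P ℕ.+ 0 ∸ P                            ≡⟨ cong (_∸ P) (ℕ.+-identityʳ _) ⟩
        q ℕ.* P ∸ P                                  ≡⟨ cong₂ _∸_ p^[2k∸m] p^[[k+k]/2∸m] ⟨
        p ^ (k ℕ.+ k ∸ m) ∸ p ^ ((k ℕ.+ k) / 2 ∸ m)  ∎)
      where
      open ≡-Reasoning
      T : 𝔽^ p m → ℕ
      T β = ∑ (e k) (λ w → # f ⁻¹ w ℕ.* h β w)
      T+P : ∀ β → T β ℕ.+ P ≡ q ℕ.* P ℕ.+ q ℕ.* h β 0ᵥ
      T+P β = begin
        T β ℕ.+ P                                            ≡⟨ cong (T β ℕ.+_) (∑h β) ⟨
        T β ℕ.+ ∑ (e k) (h β)                                ≡⟨ ∑-+ (e k) (λ w → # f ⁻¹ w ℕ.* h β w) (h β) ⟨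
        ∑ (e k) (λ w → # f ⁻¹ w ℕ.* h β w ℕ.+ h β w)         ≡⟨ ∑-cong (e k) term ⟩
        ∑ (e k) (λ w → q ℕ.* h β w ℕ.+ [ w ≟ᵛ 0ᵥ ] ℕ.* (q ℕ.* h β w))
          ≡⟨ ∑-+ (e k) (λ w → q ℕ.* h β w) (λ w → [ w ≟ᵛ 0ᵥ ] ℕ.* (q ℕ.* h β w)) ⟩
        ∑ (e k) (λ w → q ℕ.* h β w) ℕ.+ ∑ (e k) (λ w → [ w ≟ᵛ 0ᵥ ] ℕ.* (q ℕ.* h β w))
          ≡⟨ cong₂ ℕ._+_ (trans (∑-*ˡ (e k) q (h β)) (cong (q ℕ.*_) (∑h β))) (∑-δ (e k) 0ᵥ (λ w → q ℕ.* h β w)) ⟩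
        q ℕ.* P ℕ.+ q ℕ.* h β 0ᵥ ∎
        where
        rearrange : ∀ n h → n ℕ.* h ℕ.+ h ≡ (n ℕ.+ 1) ℕ.* h
        rearrange = ℕ-Solver.solve-∀
        distribute : ∀ q δ h → (q ℕ.+ δ ℕ.* q) ℕ.* h ≡ q ℕ.* h ℕ.+ δ ℕ.* (q ℕ.* h)
        distribute = ℕ-Solver.solve-∀
        term : ∀ w → # f ⁻¹ w ℕ.* h β w ℕ.+ h β w ≡ q ℕ.* h β w ℕ.+ [ w ≟ᵛ 0ᵥ ] ℕ.* (q ℕ.* h β w)
        term w = trans (rearrange (# f ⁻¹ w) (h β w)) (trans (cong (ℕ._* h β w) (#f w)) (distribute q [ w ≟ᵛ 0ᵥ ] (h β w)))

    -- Each of the `P` elements of `K` over `β` has `q + 1` preimages, except that zero has `q`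
    -- fewer. Since `P` is nonzero, `q` is at most `q * P`, so the subtraction in the exceptional
    -- size is exact.
    project-almostBalanced⁻ : ∀ f → (∀ w → # f ⁻¹ w ℕ.+ [ w ≟ᵛ 0ᵥ ] ℕ.* q ≡ suc q) → AlmostBalanced⁻ (project f)
    project-almostBalanced⁻ f #f = take m 0ᵥ ,
      fibre-cardinality (project f) f (λ _ → refl) (take m 0ᵥ) (begin
        T (take m 0ᵥ)                                ≡⟨ ℕ.m+n∸n≡m _ q ⟨
        T (take m 0ᵥ) ℕ.+ q ∸ q                      ≡⟨ cong (λ a → T (take m 0ᵥ) ℕ.+ a ∸ q) (trans (cong (q ℕ.*_) h-α) (ℕ.*-identityʳ q)) ⟨
        T (take m 0ᵥ) ℕ.+ q ℕ.* h (take m 0ᵥ) 0ᵥ ∸ q ≡⟨ cong (_∸ q) (T+q (take m 0ᵥ)) ⟩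
        P ℕ.+ q ℕ.* P ∸ q                            ≡⟨ ℕ.+-∸-assoc P (ℕ.m≤m*n q P) ⟩
        P ℕ.+ (q ℕ.* P ∸ q)                          ≡⟨ ℕ.+-comm P _ ⟩
        q ℕ.* P ∸ q ℕ.+ P                            ≡⟨ cong₂ ℕ._+_ (cong₂ _∸_ p^[2k∸m] p^[k+k]/2) p^[[k+k]/2∸m] ⟨
        p ^ (k ℕ.+ k ∸ m) ∸ p ^ ((k ℕ.+ k) / 2) ℕ.+ p ^ ((k ℕ.+ k) / 2 ∸ m) ∎) ,
      λ β β≢α → fibre-cardinality (project f) f (λ _ → refl) β (begin
        T β                                          ≡⟨ ℕ.+-identityʳ _ ⟨
        T β ℕ.+ 0                                    ≡⟨ cong (T β ℕ.+_) (trans (cong (q ℕ.*_) (h-β β β≢α)) (ℕ.*-zeroʳ q)) ⟨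
        T β ℕ.+ q ℕ.* h β 0ᵥ                         ≡⟨ T+q β ⟩
        P ℕ.+ q ℕ.* P                                ≡⟨ ℕ.+-comm P _ ⟩
        q ℕ.* P ℕ.+ P                                ≡⟨ cong₂ ℕ._+_ p^[2k∸m] p^[[k+k]/2∸m] ⟨
        p ^ (k ℕ.+ k ∸ m) ℕ.+ p ^ ((k ℕ.+ k) / 2 ∸ m)  ∎)
      where
      open ≡-Reasoning
      instance
        P≢0 : NonZero P
        P≢0 = ℕ.m^n≢0 p l
      T : 𝔽^ p m → ℕ
      T β = ∑ (e k) (λ w → # f ⁻¹ w ℕ.* h β w)
      T+q : ∀ β → T β ℕ.+ q ℕ.* h β 0ᵥ ≡ suc q ℕ.* P
      T+q β = begin
        T β ℕ.+ q ℕ.* h β 0ᵥ                                 ≡⟨ cong (T β ℕ.+_) (∑-δ (e k) 0ᵥ (λ w → q ℕ.* h β w)) ⟨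
        T β ℕ.+ ∑ (e k) (λ w → [ w ≟ᵛ 0ᵥ ] ℕ.* (q ℕ.* h β w))
          ≡⟨ ∑-+ (e k) (λ w → # f ⁻¹ w ℕ.* h β w) (λ w → [ w ≟ᵛ 0ᵥ ] ℕ.* (q ℕ.* h β w)) ⟨
        ∑ (e k) (λ w → # f ⁻¹ w ℕ.* h β w ℕ.+ [ w ≟ᵛ 0ᵥ ] ℕ.* (q ℕ.* h β w))  ≡⟨ ∑-cong (e k) term ⟩
        ∑ (e k) (λ w → suc q ℕ.* h β w)                      ≡⟨ ∑-*ˡ (e k) (suc q) (h β) ⟩
        suc q ℕ.* ∑ (e k) (h β)                              ≡⟨ cong (suc q ℕ.*_) (∑h β) ⟩
        suc q ℕ.* P                                          ∎
        where
        collect : ∀ n q δ h → n ℕ.* h ℕ.+ δ ℕ.* (q ℕ.* h) ≡ (n ℕ.+ δ ℕ.* q) ℕ.* h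
        collect = ℕ-Solver.solve-∀
        term : ∀ w → # f ⁻¹ w ℕ.* h β w ℕ.+ [ w ≟ᵛ 0ᵥ ] ℕ.* (q ℕ.* h β w) ≡ suc q ℕ.* h β w
        term w = trans (collect (# f ⁻¹ w) q [ w ≟ᵛ 0ᵥ ] (h β w)) (cong (ℕ._* h β w) (#f w))

    almostBalancedBent : (Σ (𝔽^ p (k ℕ.+ k) → 𝔽^ p m) λ F → Bent F × AlmostBalanced⁺ F) ×
                         (Σ (𝔽^ p (k ℕ.+ k) → 𝔽^ p m) λ F → Bent F × AlmostBalanced⁻ F)
    almostBalancedBent =
      (project product , project-bent product product-perfect , project-almostBalanced⁺ product #product) ,
      let f , perfect , #f = anisotropic-exists in project f , project-bent f perfect , project-almostBalanced⁻ f #f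

theorem3p12 : ∀ (p : ℕ) .{{_ : NonZero p}} → Prime p →
    ∀ (n : ℕ) → 0 < n → 2 ∣ n →
    ∀ (m : ℕ) → 0 < m → m ≤ n / 2 →
    (Σ (𝔽^ p n → 𝔽^ p m) λ F → Bent F × AlmostBalanced⁺ F) ×
    (Σ (𝔽^ p n → 𝔽^ p m) λ F → Bent F × AlmostBalanced⁻ F)
theorem3p12 p pr n 0<n (divides k n≡k*2) m 0<m m≤n/2 = subst Existence (sym n≡[m+l]+[m+l])
  (almostBalancedBent m l (fieldStructure (m ℕ.+ l) (ℕ.<-≤-trans 0<m (ℕ.m≤m+n m l))))
  where
  open BentFunctions p pr
  Existence : ℕ → Set
  Existence n = (Σ (𝔽^ p n → 𝔽^ p m) λ F → Bent F × AlmostBalanced⁺ F) ×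
                (Σ (𝔽^ p n → 𝔽^ p m) λ F → Bent F × AlmostBalanced⁻ F)
  -- Half of `n` is written as `m + l`, so that projecting the field to its first `m` coordinates is
  -- a plain `take m`.
  l = k ∸ m
  m≤k : m ≤ k
  m≤k = subst (m ≤_) (trans (cong (_/ 2) n≡k*2) (m*n/n≡m k 2)) m≤n/2
  n≡[m+l]+[m+l] : n ≡ (m ℕ.+ l) ℕ.+ (m ℕ.+ l)
  n≡[m+l]+[m+l] = begin
    n                                ≡⟨ n≡k*2 ⟩
    k ℕ.* 2                          ≡⟨ ℕ.*-comm k 2 ⟩
    k ℕ.+ (k ℕ.+ 0)                  ≡⟨ cong (k ℕ.+_) (ℕ.+-identityʳ k) ⟩
    k ℕ.+ k                          ≡⟨ cong₂ ℕ._+_ (ℕ.m+[n∸m]≡n m≤k) (ℕ.m+[n∸m]≡n m≤k) ⟨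
    (m ℕ.+ l) ℕ.+ (m ℕ.+ l)          ∎
    where open ≡-Reasoning
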